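{- Let $D$ be an arc-colored digraph on $n\geq 3$ vertices. If \[a(D)+c(D)\geq\begin{cases} n(n-1)+\lfloor\frac{n^{2}}{4}\rfloor+3,&\text{if } n=3, 4;\\ n(n-1)+\lfloor\frac{n^{2}}{4}\rfloor+2,&\text{if } n\geq 5, \end{cases}\] then $D$ contains a rainbow triangle.
   Context: Digraphs are finite, without loops or multiple arcs. $a(D)$ is the number of arcs of $D$. An arc-coloring of $D$ is a map $C:A(D)\to\mathbb{N}$; $c(D)$ is the number of distinct colors used on the arcs of $D$. A rainbow triangle is a directed cycle of length $3$ whose three arcs have pairwise distinct colors. -}

module Defs where

open import Data.Nat using (ℕ; _+_; _*_; _∸_; _/_; _≤_; _≥_)
open import Data.Nat.Properties using (_≟_)
open import Data.Bool using (Bool; true; false; T)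
open import Data.Fin using (Fin)
open import Data.List using (List; length; filter; map; cartesianProduct; allFin; deduplicate)
open import Data.Product using (_×_; _,_; proj₁; proj₂; ∃-syntax)
open import Relation.Nullary using (¬_)
open import Relation.Nullary.Decidable using (T?)
open import Relation.Binary.PropositionalEquality using (_≡_)

record Digraph (n : ℕ) : Set where
  field
    arc    : Fin n → Fin n → Bool
    noLoop : ∀ v → arc v v ≡ false
open Digraph public

-- An arc-colouring: a colour in ℕ for each ordered pair; only the values on
-- arcs of D matter.
ArcColoring : ℕ → Set
ArcColoring n = Fin n → Fin n → ℕ

arcs : ∀ {n} → Digraph n → List (Fin n × Fin n)
arcs {n} D = filter (λ p → T? (arc D (proj₁ p) (proj₂ p)))
                    (cartesianProduct (allFin n) (allFin n))

a : ∀ {n} → Digraph n → ℕ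
a D = length (arcs D)

c : ∀ {n} → Digraph n → ArcColoring n → ℕ
c D C = length (deduplicate _≟_ (map (λ p → C (proj₁ p) (proj₂ p)) (arcs D)))

RainbowTriangle : ∀ {n} → Digraph n → ArcColoring n → Set
RainbowTriangle {n} D C =
  ∃[ x ] ∃[ y ] ∃[ z ]
    ( T (arc D x y) × T (arc D y z) × T (arc D z x)
    × ¬ (C x y ≡ C y z) × ¬ (C y z ≡ C z x) × ¬ (C x y ≡ C z x) )

bound : ℕ → ℕ
bound n = n * (n ∸ 1) + (n * n) / 4 + extra n
  where
  extra : ℕ → ℕ
  extra 3 = 3
  extra 4 = 3
  extra _ = 2

{-# OPTIONS --safe #-}
module Submission where

open import Defs
open import Data.Nat using (ℕ; zero; suc; _+_; _*_; _/_; _≤_; _<_; _≥_; z≤n; s≤s; _≤ᵇ_; s≤s⁻¹)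
open import Data.Nat.Properties using (≤-refl; ≤-trans; ≤-reflexive; +-mono-≤; +-monoʳ-≤; m≤m+n; m≤n+m; <⇒≱; ≤-total; +-comm; +-suc; +-cancelˡ-≤; +-cancelʳ-≤; module ≤-Reasoning; ≤ᵇ⇒≤; ≰⇒>) renaming (_≟_ to _≟ℕ_; _≤?_ to _≤?ℕ_)
open import Data.Nat.Tactic.RingSolver using (solve)
open import Data.Bool using (Bool; true; false; T; if_then_else_; _∧_; _∨_)
open import Data.Empty using (⊥; ⊥-elim)
open import Data.Fin using (Fin; zero; suc; punchIn)
open import Data.Fin.Properties using (_≟_; any?; all?; punchIn-punchOut)
open import Data.List using (List; []; _∷_; _++_; length; map; filter; allFin; cartesianProduct; deduplicate)
open import Data.List.Properties using (length-++; length-++-sucʳ; length-tabulate; length-map; length-deduplicate)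
open import Data.List.Membership.Propositional using (_∈_; find)
open import Data.List.Membership.Propositional.Properties using (∈-∃++; ∈-++⁻; ∈-++⁺ˡ; ∈-++⁺ʳ; ∈-filter⁺; ∈-filter⁻; ∈-allFin; ∈-map⁺; ∈-map⁻; ∈-deduplicate⁺; ∈-deduplicate⁻; ∈-cartesianProduct⁺; ∈-cartesianProduct⁻)
open import Data.List.Relation.Unary.All as All using (All)
open import Data.List.Relation.Unary.All.Properties using (¬All⇒Any¬)
open import Data.List.Relation.Unary.AllPairs using () renaming ([] to []!; _∷_ to _∷!_)
open import Data.List.Relation.Unary.Any using (here; there)
open import Data.List.Relation.Unary.Unique.Propositional using (Unique)
open import Data.List.Relation.Unary.Unique.Propositional.Properties using (filter⁺; allFin⁺; cartesianProduct⁺)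
open import Data.List.Relation.Binary.Subset.Propositional using (_⊆_)
open import Data.Product using (∃-syntax; _×_; _,_; proj₁; proj₂) renaming (swap to swap-×)
open import Data.Sum using (_⊎_; inj₁; inj₂; swap; [_,_]′)
open import Function using (_∘_; id; flip; Equivalence)
open import Relation.Nullary using (Dec; yes; no; ¬_; contradiction; does)
open import Relation.Nullary.Decidable using (T?; ¬?; _×-dec_; decidable-stable; _→-dec_; _⊎-dec_; from-yes)
open import Relation.Unary using (Decidable)
open import Relation.Binary using (DecidableEquality)
open import Relation.Binary.PropositionalEquality using (_≡_; _≢_; refl; sym; trans; cong; subst; cong₂)
open import Data.Bool.Properties using (T-∧)
open import Data.Unit using (tt)
open import Data.List.Relation.Unary.Unique.DecPropositional.Properties using (deduplicate-!)
open import Data.Product.Properties using (≡-dec)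
open import Data.Nat.DivMod using (/-congˡ; m*n/n≡m; +-distrib-/-∣ʳ)
open import Data.Nat.Divisibility using (divides)
import Data.List.Membership.DecPropositional as DecMembership
import Data.List.Relation.Unary.All.Properties as All

-- Let S v be the set of colours that disappear when v is deleted, m(v) the number of arcs missing at v and
-- k = ⌊n/2⌋. Deleting v lowers a + c by 2(n − 1) − m(v) + |S v|, so by induction on n one may assume that
-- |S v| ≥ k + 1 + m(v) for all v (n = 5 is exceptional). If u → x and y → u have different colours of S u,
-- then x → y is missing. Hence a vertex that has colours of S u on both outgoing and incoming arcs forces
-- vertices with many missing arcs, whose sets S are then larger still, and extremal choices show that every
-- vertex is pure: the colours of S u are only on arcs out of u or only on arcs into u. An arc u → x with colour
-- in S u cannot join two vertices of the first kind, so there are at most n − k − 1 of these; the same holds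
-- for the second kind, and 2(n − k − 1) < n.
--
-- The bound for n = 5 exceeds the bound for n = 4 by one less than this induction needs. The missing
-- case is that of a vertex whose deletion leaves an extremal configuration on 4 vertices; such a
-- configuration is complete and properly coloured, which leaves no room for the colours of S v.

-- Linear arithmetic and counting in lists

-- Linear arithmetic: the hypotheses are added up to a single `l ≤ r`, and the ring solver checks
-- the identity that refutes it. `d` absorbs any further surplus.
surplus⇒⊥ : ∀ d {l r} → l ≤ r → l ≡ suc (d + r) → ⊥
surplus⇒⊥ d {r = r} l≤r refl = <⇒≱ (s≤s (m≤n+m r d)) l≤r

-- The same device for proving an inequality; `d` is what the added hypotheses give beyond the goal.
slack : ∀ d {l r m n} → l ≤ r → m + (d + r) ≡ n + l → m ≤ n
slack d {l} {r} {m} {n} l≤r eq = +-cancelʳ-≤ r _ _ (begin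
  m + r        ≤⟨ +-monoʳ-≤ m (m≤n+m r d) ⟩
  m + (d + r)  ≡⟨ eq ⟩
  n + l        ≤⟨ +-monoʳ-≤ n l≤r ⟩
  n + r        ∎)
  where open ≤-Reasoning

-- A relation rather than a function, so that a colour may be matched with any vertex whose arc
-- carries it; injectivity is then mostly immediate, as an arc has only one colour.
pigeonhole : {A B : Set} (R : A → B → Set) {xs : List A} {ys : List B} → Unique xs →
             (∀ {x} → x ∈ xs → ∃[ y ] y ∈ ys × R x y) →
             (∀ {x x′ y} → x ∈ xs → x′ ∈ xs → R x y → R x′ y → x ≡ x′) →
             length xs ≤ length ys
pigeonhole R []! total inj = z≤n
pigeonhole R {x ∷ xs} (x∉xs ∷! xs!) total inj with total (here refl)
... | y , y∈ys , xRy with ∈-∃++ y∈ys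
... | as , bs , refl = subst (suc (length xs) ≤_) (sym (length-++-sucʳ as y bs))
                             (s≤s (pigeonhole R xs! total′ λ p q → inj (there p) (there q)))
  where
  total′ : ∀ {x′} → x′ ∈ xs → ∃[ y′ ] y′ ∈ as ++ bs × R x′ y′
  total′ x′∈xs with total (there x′∈xs)
  ... | y′ , y′∈ , x′Ry′ with ∈-++⁻ as y′∈
  ... | inj₁ y′∈as = y′ , ∈-++⁺ˡ y′∈as , x′Ry′
  ... | inj₂ (there y′∈bs) = y′ , ∈-++⁺ʳ as y′∈bs , x′Ry′
  ... | inj₂ (here refl) = contradiction (inj (here refl) (there x′∈xs) xRy x′Ry′)
                                         (All.lookup x∉xs x′∈xs)

⊆⇒length≤ : {A : Set} {xs ys : List A} → Unique xs → xs ⊆ ys → length xs ≤ length ys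
⊆⇒length≤ xs! xs⊆ys = pigeonhole _≡_ xs! (λ x∈ → _ , xs⊆ys x∈ , refl) (λ { _ _ refl refl → refl })

length-filter-∁ : {A : Set} {P : A → Set} (P? : Decidable P) (xs : List A) →
                  length (filter P? xs) + length (filter (¬? ∘ P?) xs) ≡ length xs
length-filter-∁ P? [] = refl
length-filter-∁ P? (x ∷ xs) with P? x
... | yes _ = cong suc (length-filter-∁ P? xs)
... | no  _ = trans (+-suc _ _) (cong suc (length-filter-∁ P? xs))

maximum : {A : Set} (f : A → ℕ) {xs : List A} {x : A} → x ∈ xs →
          ∃[ m ] m ∈ xs × (∀ {y} → y ∈ xs → f y ≤ f m)
maximum f {x ∷ []} _ = x , here refl , λ { (here refl) → ≤-refl }
maximum f {x ∷ x′ ∷ xs} _ with maximum f {x′ ∷ xs} (here refl)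
... | m , m∈ , max with ≤-total (f x) (f m)
... | inj₁ fx≤fm = m , there m∈ , λ { (here refl) → fx≤fm ; (there y∈) → max y∈ }
... | inj₂ fm≤fx = x , here refl , λ { (here refl) → ≤-refl ; (there y∈) → ≤-trans (max y∈) fm≤fx }

inhabited : {A : Set} {xs : List A} → 1 ≤ length xs → ∃[ x ] x ∈ xs
inhabited {xs = x ∷ xs} _ = x , here refl

module _ {A : Set} (_≈?_ : DecidableEquality A) where

  infixl 6 _without_
  _without_ : List A → A → List A
  xs without x = filter (λ y → ¬? (y ≈? x)) xs

  ∈-without⁺ : ∀ {xs x y} → y ∈ xs → y ≢ x → y ∈ xs without x
  ∈-without⁺ = ∈-filter⁺ _

  ∈-without⁻ : ∀ xs {x y} → y ∈ xs without x → y ∈ xs × y ≢ x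
  ∈-without⁻ xs = ∈-filter⁻ _ {xs = xs}

  without⁺ : ∀ {xs} x → Unique xs → Unique (xs without x)
  without⁺ x = filter⁺ _

  length≤1+without : ∀ {xs} x → Unique xs → length xs ≤ suc (length (xs without x))
  length≤1+without {xs} x xs! = ⊆⇒length≤ xs! sub
    where
    sub : xs ⊆ x ∷ xs without x
    sub {y} y∈ with y ≈? x
    ... | yes refl = here refl
    ... | no  y≢x  = there (∈-without⁺ y∈ y≢x)

  1+without≤length : ∀ {xs x} → Unique xs → x ∈ xs → suc (length (xs without x)) ≤ length xs
  1+without≤length {xs} {x} xs! x∈ = ⊆⇒length≤ (All.tabulate (λ y∈ → proj₂ (∈-without⁻ xs y∈) ∘ sym) ∷! without⁺ x xs!)
                                              λ { (here refl) → x∈ ; (there y∈) → proj₁ (∈-without⁻ xs y∈) }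

  fresh : ∀ {xs x y} → Unique xs → 3 ≤ length xs → ∃[ z ] z ∈ xs × z ≢ x × z ≢ y
  fresh {xs} {x} {y} xs! 3≤ = outside (inhabited {xs = xs without x without y} (cancel 3≤ (length≤1+without x xs!) (length≤1+without y (without⁺ x xs!))))
    where
    cancel : ∀ {l m n} → 3 ≤ l → l ≤ suc m → m ≤ suc n → 1 ≤ n
    cancel {l} {m} {n} h₁ h₂ h₃ = slack 0 (+-mono-≤ h₁ (+-mono-≤ h₂ h₃)) (solve (l ∷ m ∷ n ∷ []))
    outside : (∃[ z ] z ∈ xs without x without y) → ∃[ z ] z ∈ xs × z ≢ x × z ≢ y
    outside (z , z∈) with ∈-without⁻ (xs without x) z∈
    ... | z∈′ , z≢y with ∈-without⁻ xs z∈′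
    ... | z∈xs , z≢x = z , z∈xs , z≢x , z≢y

-- Vertices, missing arcs and configurations

others : ∀ {n} → Fin n → List (Fin n)
others v = _without_ _≟_ (allFin _) v

others! : ∀ {n} (v : Fin n) → Unique (others v)
others! v = without⁺ _≟_ v (allFin⁺ _)

∈-others : ∀ {n} {v x : Fin n} → x ≢ v → x ∈ others v
∈-others = ∈-without⁺ _≟_ (∈-allFin _)

length-allFin : ∀ n → length (allFin n) ≡ n
length-allFin n = length-tabulate id

1+length-others≤n : ∀ {n} (v : Fin n) → suc (length (others v)) ≤ n
1+length-others≤n {n} v = subst (suc (length (others v)) ≤_) (length-allFin n) (1+without≤length _≟_ (allFin⁺ n) (∈-allFin v))

n≤1+length-others : ∀ {n} (v : Fin n) → n ≤ suc (length (others v))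
n≤1+length-others {n} v = subst (_≤ suc (length (others v))) (length-allFin n) (length≤1+without _≟_ v (allFin⁺ n))

_ᵒ : ∀ {n} → Digraph n → Digraph n
D ᵒ = record { arc = λ x y → arc D y x ; noLoop = noLoop D }

Arc : ∀ {n} → Digraph n → Fin n → Fin n → Set
Arc D x y = T (arc D x y)

arc⇒≢ : ∀ {n} (D : Digraph n) {x y} → Arc D x y → x ≢ y
arc⇒≢ D xy refl = subst T (noLoop D _) xy

missing : ∀ {n} → Digraph n → Fin n → List (Fin n)
missing D v = filter (λ x → ¬? (T? (arc D v x))) (others v)

∈-missing : ∀ {n} {D : Digraph n} {v x} → x ≢ v → ¬ Arc D v x → x ∈ missing D v
∈-missing x≢v ¬vx = ∈-filter⁺ _ (∈-others x≢v) ¬vx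

NonRainbow : ∀ {n} → Digraph n → ArcColoring n → Set
NonRainbow D C = ∀ x y z → Arc D x y → Arc D y z → Arc D z x →
                 C x y ≡ C y z ⊎ C y z ≡ C z x ⊎ C x y ≡ C z x

nonRainbow-ᵒ : ∀ {n} {D : Digraph n} {C} → NonRainbow D C → NonRainbow (D ᵒ) (flip C)
nonRainbow-ᵒ nr x y z yx zy xz with nr z y x zy yx xz
... | inj₁ p = inj₁ (sym p)
... | inj₂ (inj₁ p) = inj₂ (inj₂ p)
... | inj₂ (inj₂ p) = inj₂ (inj₁ p)

-- S v is the set of colours that are lost when v is deleted.
record Config (n : ℕ) : Set where
  field
    D          : Digraph n
    C          : ArcColoring n
    nonRainbow : NonRainbow D C
    S          : Fin n → List ℕ
    S!         : ∀ v → Unique (S v)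
    incident   : ∀ {v α x y} → α ∈ S v → Arc D x y → C x y ≡ α → x ≡ v ⊎ y ≡ v
    used       : ∀ {v α} → α ∈ S v → (∃[ x ] Arc D v x × C v x ≡ α) ⊎ (∃[ y ] Arc D y v × C y v ≡ α)

  Out : Fin n → ℕ → Set
  Out v α = ∃[ x ] Arc D v x × C v x ≡ α

  Out? : ∀ v → Decidable (Out v)
  Out? v α = any? λ x → T? (arc D v x) ×-dec (C v x ≟ℕ α)

-- `S` is a field instead of being computed from `D` and `C`, so reversing all arcs leaves it
-- untouched, and each result on outgoing arcs yields its mirror image.
dual : ∀ {n} → Config n → Config n
dual G = record
  { D = D ᵒ ; C = flip C ; S = S ; S! = S!
  ; nonRainbow = nonRainbow-ᵒ {D = D} nonRainbow
  ; incident = λ α∈ yx eq → swap (incident α∈ yx eq)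
  ; used = swap ∘ used }
  where
  open Config G

-- Local structure at a vertex

module _ {n} (G : Config n) where
  open Config G
  open Config (dual G) using () renaming (Out to In; Out? to In?)

  avoids : ∀ {v α x y} → α ∈ S v → x ≢ v → y ≢ v → Arc D x y → C x y ≢ α
  avoids α∈ x≢v y≢v xy eq = [ x≢v , y≢v ]′ (incident α∈ xy eq)

  -- The arc `x → y` would avoid `u`, hence carry neither `α` nor `β`, and close a rainbow triangle.
  opposite-missing : ∀ {u x y α β} → α ∈ S u → β ∈ S u → α ≢ β →
                     Arc D u x → C u x ≡ α → Arc D y u → C y u ≡ β → ¬ Arc D x y
  opposite-missing α∈ β∈ α≢β ux refl yu refl xy with nonRainbow _ _ _ ux xy yu
  ... | inj₁ eq = avoids α∈ (arc⇒≢ D ux ∘ sym) (arc⇒≢ D yu) xy (sym eq)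
  ... | inj₂ (inj₁ eq) = avoids β∈ (arc⇒≢ D ux ∘ sym) (arc⇒≢ D yu) xy eq
  ... | inj₂ (inj₂ eq) = α≢β eq

  -- Otherwise `u → x → w → u` is rainbow: `x → w` avoids `u` and so is not coloured `α`, while
  -- `w → u` avoids `x` and enters `u`, which excludes `β` and `α`.
  return-missing : ∀ {u x w α β} → α ∈ S u → ¬ In u α → Arc D u x → C u x ≡ α →
                   β ∈ S x → Arc D x w → C x w ≡ β → w ≢ u → ¬ Arc D w u
  return-missing α∈ α∉In ux refl β∈ xw refl w≢u wu with nonRainbow _ _ _ ux xw wu
  ... | inj₁ eq = avoids α∈ (arc⇒≢ D ux ∘ sym) w≢u xw (sym eq)
  ... | inj₂ (inj₁ eq) = avoids β∈ (arc⇒≢ D xw ∘ sym) (arc⇒≢ D ux) wu (sym eq)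
  ... | inj₂ (inj₂ eq) = α∉In (_ , wu , sym eq)

  miss : Fin n → ℕ
  miss v = length (missing D v) + length (missing (D ᵒ) v)

  missingIn≤miss : ∀ v → length (missing (D ᵒ) v) ≤ miss v
  missingIn≤miss v = m≤n+m _ _

  no-miss⇒arc : ∀ {u t} → miss u ≤ 0 → t ≢ u → Arc D t u
  no-miss⇒arc {u} {t} m≤0 t≢u = decidable-stable (T? _) λ ¬tu →
    empty (∈-missing {D = D ᵒ} t≢u ¬tu) (≤-trans (missingIn≤miss u) m≤0)
    where
    empty : ∀ {x} {xs : List (Fin n)} → x ∈ xs → length xs ≤ 0 → ⊥
    empty (here _) ()
    empty (there _) ()

  degS : Fin n → ℕ
  degS v = length (S v)

  NoDigon : Fin n → Set
  NoDigon u = ∀ {α β z} → α ∈ S u → β ∈ S u → α ≢ β →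
              Arc D u z → C u z ≡ α → Arc D z u → C z u ≡ β → ⊥

  PureIn : Fin n → Set
  PureIn v = All (¬_ ∘ Out v) (S v)

  pureIn? : Decidable PureIn
  pureIn? v = All.all? (¬? ∘ Out? v) (S v)

  -- By `opposite-missing`, the heads of arcs out of `u` in the colours of `L` send no arc to `y`.
  -- They differ from `y` by `nodigon` and from each other by their colours.
  outs-missing : ∀ {u y β L} → NoDigon u → β ∈ S u → Arc D y u → C y u ≡ β → Unique L →
                 (∀ {α} → α ∈ L → α ∈ S u × Out u α × α ≢ β) →
                 length L ≤ length (missing (D ᵒ) y)
  outs-missing {u} {y} {β} {L} nodigon β∈ yu yu≡β L! out = pigeonhole (λ α x → C u x ≡ α) L! total λ { _ _ refl refl → refl }
    where
    total : ∀ {α} → α ∈ L → ∃[ x ] x ∈ missing (D ᵒ) y × C u x ≡ α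
    total α∈L with out α∈L
    ... | α∈ , (x , ux , ux≡α) , α≢β =
      x , ∈-missing {D = D ᵒ} (λ { refl → nodigon α∈ β∈ α≢β ux ux≡α yu yu≡β })
                    (opposite-missing α∈ β∈ α≢β ux ux≡α yu yu≡β) , ux≡α

  -- Each colour of `S v` is matched with a neighbour of `v`; without a digon no neighbour serves
  -- two colours.
  nodigon⇒1+degS≤n : ∀ {v} → NoDigon v → suc (degS v) ≤ n
  nodigon⇒1+degS≤n {v} nodigon = ≤-trans (s≤s (pigeonhole R (S! v) total inj)) (1+length-others≤n v)
    where
    R : ℕ → Fin n → Set
    R α x = Arc D v x × C v x ≡ α ⊎ Arc D x v × C x v ≡ α
    total : ∀ {α} → α ∈ S v → ∃[ x ] x ∈ others v × R α x
    total α∈ with used α∈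
    ... | inj₁ (x , vx , eq) = x , ∈-others (arc⇒≢ D vx ∘ sym) , inj₁ (vx , eq)
    ... | inj₂ (x , xv , eq) = x , ∈-others (arc⇒≢ D xv) , inj₂ (xv , eq)
    inj : ∀ {α β x} → α ∈ S v → β ∈ S v → R α x → R β x → α ≡ β
    inj _ _ (inj₁ (_ , refl)) (inj₁ (_ , refl)) = refl
    inj _ _ (inj₂ (_ , refl)) (inj₂ (_ , refl)) = refl
    inj {α} {β} α∈ β∈ (inj₁ (vx , p)) (inj₂ (xv , q)) with α ≟ℕ β
    ... | yes α≡β = α≡β
    ... | no  α≢β = ⊥-elim (nodigon α∈ β∈ α≢β vx p xv q)
    inj {α} {β} α∈ β∈ (inj₂ (xv , q)) (inj₁ (vx , p)) with α ≟ℕ β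
    ... | yes α≡β = α≡β
    ... | no  α≢β = ⊥-elim (nodigon β∈ α∈ (α≢β ∘ sym) vx p xv q)

  -- Every colour of `S u` other than `α` and `β` costs an arc at `z`: on `u → x` it is played
  -- against `z → u`, and `x → z` is missing; on `y → u` it is played against `u → z`, and `z → y`
  -- is missing.
  digon⇒degS≤2+miss : ∀ {u α β z} → α ∈ S u → β ∈ S u → α ≢ β →
                      Arc D u z → C u z ≡ α → Arc D z u → C z u ≡ β → degS u ≤ 2 + miss z
  digon⇒degS≤2+miss {u} {α} {β} {z} α∈ β∈ α≢β uz uz≡α zu zu≡β = begin
    length (S u)                                                   ≤⟨ length≤1+without _≟ℕ_ α (S! u) ⟩
    1 + length (S u ∖ α)                                           ≤⟨ s≤s (length≤1+without _≟ℕ_ β (without⁺ _≟ℕ_ α (S! u))) ⟩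
    2 + length S′                                                  ≡⟨ cong (2 +_) (length-filter-∁ (Out? u) S′) ⟨
    2 + (length (filter (Out? u) S′) + length (filter (¬? ∘ Out? u) S′))
      ≤⟨ +-monoʳ-≤ 2 (+-mono-≤ (pigeonhole (λ γ x → C u x ≡ γ) (filter⁺ (Out? u) S′!) outs λ { _ _ refl refl → refl })
                               (pigeonhole (λ γ y → C y u ≡ γ) (filter⁺ (¬? ∘ Out? u) S′!) ins λ { _ _ refl refl → refl })) ⟩
    2 + (length (missing (D ᵒ) z) + length (missing D z))          ≡⟨ cong (2 +_) (+-comm (length (missing (D ᵒ) z)) _) ⟩
    2 + miss z                                                     ∎
    where
    open ≤-Reasoning
    infixl 6 _∖_
    _∖_ = _without_ _≟ℕ_
    S′ = S u ∖ α ∖ β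
    S′! : Unique S′
    S′! = without⁺ _≟ℕ_ β (without⁺ _≟ℕ_ α (S! u))
    parts : ∀ {γ} → γ ∈ S′ → γ ∈ S u × γ ≢ α × γ ≢ β
    parts γ∈ with ∈-without⁻ _≟ℕ_ (S u ∖ α) γ∈
    ... | γ∈′ , γ≢β with ∈-without⁻ _≟ℕ_ (S u) γ∈′
    ... | γ∈″ , γ≢α = γ∈″ , γ≢α , γ≢β
    outs : ∀ {γ} → γ ∈ filter (Out? u) S′ → ∃[ x ] x ∈ missing (D ᵒ) z × C u x ≡ γ
    outs γ∈ with ∈-filter⁻ (Out? u) {xs = S′} γ∈
    ... | γ∈S′ , (x , ux , ux≡γ) with parts γ∈S′
    ... | γ∈S , γ≢α , γ≢β = x , ∈-missing {D = D ᵒ} (λ { refl → γ≢α (trans (sym ux≡γ) uz≡α) })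
                                          (opposite-missing γ∈S β∈ γ≢β ux ux≡γ zu zu≡β) , ux≡γ
    ins : ∀ {γ} → γ ∈ filter (¬? ∘ Out? u) S′ → ∃[ y ] y ∈ missing D z × C y u ≡ γ
    ins γ∈ with ∈-filter⁻ (¬? ∘ Out? u) {xs = S′} γ∈
    ... | γ∈S′ , γ∉Out with parts γ∈S′
    ... | γ∈S , γ≢α , γ≢β with used γ∈S
    ... | inj₁ out = contradiction out γ∉Out
    ... | inj₂ (y , yu , yu≡γ) = y , ∈-missing {D = D} (λ { refl → γ≢β (trans (sym yu≡γ) zu≡β) })
                                               (opposite-missing α∈ γ∈S (γ≢α ∘ sym) uz uz≡α yu yu≡γ) , yu≡γ

  impure : ∀ {v} → ¬ PureIn v → ∃[ α ] α ∈ S v × Out v α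
  impure {v} ¬pure with find (¬All⇒Any¬ (¬? ∘ Out? v) (S v) ¬pure)
  ... | α , α∈ , ¬¬out = α , α∈ , decidable-stable (Out? v α) ¬¬out

-- Dense configurations and vertices of maximum `degS`

PureOut : ∀ {n} → Config n → Fin n → Set
PureOut G = PureIn (dual G)

pureOut? : ∀ {n} (G : Config n) → Decidable (PureOut G)
pureOut? G = pureIn? (dual G)

Mixed : ∀ {n} → Config n → Fin n → Set
Mixed G v = ¬ PureIn G v × ¬ PureOut G v

mixed? : ∀ {n} (G : Config n) → Decidable (Mixed G)
mixed? G v = ¬? (pureIn? G v) ×-dec ¬? (pureOut? G v)

miss-ᵒ : ∀ {n} (G : Config n) v → miss G v ≡ miss (dual G) v
miss-ᵒ G v = +-comm (length (missing (Config.D G) v)) _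

-- What the induction forces on a counterexample; of `k = ⌊n/2⌋` only the two inequalities on `k`
-- are kept.
record Dense {n} (G : Config n) : Set where
  open Config G
  field
    k     : ℕ
    2≤k   : 2 ≤ k
    n≤    : n ≤ 1 + (k + k)
    dense : ∀ v → suc k + miss G v ≤ degS G v

dual-dense : ∀ {n} {G : Config n} → Dense G → Dense (dual G)
dual-dense {G = G} H = record
  { k = k ; 2≤k = 2≤k ; n≤ = n≤
  ; dense = λ v → subst (λ m → suc k + m ≤ length (S v)) (miss-ᵒ G v) (dense v) }
  where
  open Config G
  open Dense H

module _ {n} {G : Config n} (H : Dense G) where
  open Config G
  open Config (dual G) using () renaming (Out to In; Out? to In?)
  open Dense H

  -- A digon with `z` would give `degS v ≤ 2 + miss z`, whereas density at `z` and maximality give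
  -- `degS v ≥ k + 1 + miss z` with `k ≥ 2`.
  max⇒nodigon : ∀ {v} → (∀ w → degS G w ≤ degS G v) → NoDigon G v
  max⇒nodigon {v} max {z = z} α∈ β∈ α≢β vz p zv q =
    clash (degS G v) (miss G z) (digon⇒degS≤2+miss G α∈ β∈ α≢β vz p zv q) (≤-trans (dense z) (max z)) 2≤k
    where
    clash : ∀ {k} s m → s ≤ 2 + m → suc k + m ≤ s → 2 ≤ k → ⊥
    clash {k} s m h₁ h₂ h₃ = surplus⇒⊥ 0 (+-mono-≤ h₁ (+-mono-≤ h₂ h₃)) (solve (k ∷ s ∷ m ∷ []))

  -- If `y → v` has a colour of `S v`, every other outgoing colour costs `y` an arc and thus
  -- enlarges `S y`. As `S y` is no larger than `S v`, the outgoing colours leave room for many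
  -- others.
  max⇒many-only-in : ∀ {v β} → (∀ w → degS G w ≤ degS G v) → β ∈ S v → In v β →
                     suc k ≤ length (filter (¬? ∘ Out? v) (S v))
  max⇒many-only-in {v} {β} max β∈ (y , yv , yv≡β) = extend (inhabited (≤-trans (≤-trans (s≤s z≤n) 2≤k) k≤onlyIn))
    where
    outs = filter (Out? v) (S v)
    onlyIn = filter (¬? ∘ Out? v) (S v)
    outs! : Unique outs
    outs! = filter⁺ (Out? v) (S! v)
    nodigon = max⇒nodigon max
    bound-by-max : ∀ y {o} → o ≤ length (missing (D ᵒ) y) → suc k + o ≤ length outs + length onlyIn
    bound-by-max y {o} o≤ = begin
      suc k + o                    ≤⟨ +-monoʳ-≤ (suc k) (≤-trans o≤ (missingIn≤miss G y)) ⟩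
      suc k + miss G y             ≤⟨ dense y ⟩
      degS G y                     ≤⟨ max y ⟩
      degS G v                     ≡⟨ length-filter-∁ (Out? v) (S v) ⟨
      length outs + length onlyIn  ∎
      where open ≤-Reasoning
    k≤onlyIn : k ≤ length onlyIn
    k≤onlyIn = cancel (bound-by-max y (outs-missing G nodigon β∈ yv yv≡β (without⁺ _≟ℕ_ β outs!) out))
                      (length≤1+without _≟ℕ_ β outs!)
      where
      out : ∀ {α} → α ∈ _without_ _≟ℕ_ outs β → α ∈ S v × Out v α × α ≢ β
      out α∈ with ∈-without⁻ _≟ℕ_ outs α∈
      ... | α∈outs , α≢β with ∈-filter⁻ (Out? v) {xs = S v} α∈outs
      ... | α∈S , α-out = α∈S , α-out , α≢β
      cancel : ∀ {k o o′ i} → suc k + o ≤ o′ + i → o′ ≤ suc o → k ≤ i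
      cancel {k} {o} {o′} {i} h₁ h₂ = slack 0 (+-mono-≤ h₁ h₂) (solve (k ∷ o ∷ o′ ∷ i ∷ []))
    -- The first pass loses one, since `β` may itself be outgoing. It still yields a colour `γ` that
    -- is only incoming, and the same count with `γ` in place of `β` loses nothing.
    extend : (∃[ γ ] γ ∈ onlyIn) → suc k ≤ length onlyIn
    extend (γ , γ∈) with ∈-filter⁻ (¬? ∘ Out? v) {xs = S v} γ∈
    ... | γ∈S , γ∉Out with used γ∈S
    ... | inj₁ γ-out = contradiction γ-out γ∉Out
    ... | inj₂ (y′ , y′v , y′v≡γ) =
      +-cancelʳ-≤ (length outs) _ _ (≤-trans (bound-by-max y′ (outs-missing G nodigon γ∈S y′v y′v≡γ outs! out))
                                             (≤-reflexive (+-comm (length outs) _)))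
      where
      out : ∀ {α} → α ∈ outs → α ∈ S v × Out v α × α ≢ γ
      out α∈ with ∈-filter⁻ (Out? v) {xs = S v} α∈
      ... | α∈S , α-out = α∈S , α-out , λ { refl → γ∉Out α-out }

module _ {n} {G : Config n} (H : Dense G) where
  open Config G
  open Config (dual G) using () renaming (Out to In; Out? to In?)
  open Dense H

  -- A vertex of maximum `degS` has no digon, so the bound holds there and hence everywhere.
  1+degS≤n : ∀ w → suc (degS G w) ≤ n
  1+degS≤n w with maximum (degS G) (∈-allFin w)
  ... | v , _ , max = ≤-trans (s≤s (max′ w)) (nodigon⇒1+degS≤n G nodigon)
    where
    max′ : ∀ w → degS G w ≤ degS G v
    max′ w = max (∈-allFin w)
    nodigon = max⇒nodigon H max′

  miss<k : ∀ v → miss G v < k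
  miss<k v = cancel (dense v) (1+degS≤n v) n≤
    where
    cancel : ∀ {k s m n} → suc k + m ≤ s → suc s ≤ n → n ≤ 1 + (k + k) → suc m ≤ k
    cancel {k} {s} {m} {n} h₁ h₂ h₃ = slack 0 (+-mono-≤ h₁ (+-mono-≤ h₂ h₃)) (solve (k ∷ s ∷ m ∷ n ∷ []))

  -- Colours in both directions would give `k + 1` that are only outgoing and `k + 1` that are only
  -- incoming, too many for `degS v ≤ n - 1 ≤ 2k`.
  max⇒pure : ∀ {v α β} → (∀ w → degS G w ≤ degS G v) → α ∈ S v → Out v α → β ∈ S v → In v β → ⊥
  max⇒pure {v} max α∈ α-out β∈ β-in =
    clash (≤-trans (max⇒many-only-in (dual-dense H) max α∈ α-out) (⊆⇒length≤ (filter⁺ (¬? ∘ In? v) (S! v)) onlyOut⊆outs))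
          (max⇒many-only-in H max β∈ β-in) (≤-reflexive (length-filter-∁ (Out? v) (S v))) (1+degS≤n v) n≤
    where
    onlyOut⊆outs : filter (¬? ∘ In? v) (S v) ⊆ filter (Out? v) (S v)
    onlyOut⊆outs γ∈ with ∈-filter⁻ (¬? ∘ In? v) {xs = S v} γ∈
    ... | γ∈S , γ∉In with used γ∈S
    ... | inj₁ γ-out = ∈-filter⁺ (Out? v) γ∈S γ-out
    ... | inj₂ γ-in = contradiction γ-in γ∉In
    clash : ∀ {k o i s n} → suc k ≤ o → suc k ≤ i → o + i ≤ s → suc s ≤ n → n ≤ 1 + (k + k) → ⊥
    clash {k} {o} {i} {s} {n} h₁ h₂ h₃ h₄ h₅ =
      surplus⇒⊥ 1 (+-mono-≤ h₁ (+-mono-≤ h₂ (+-mono-≤ h₃ (+-mono-≤ h₄ h₅)))) (solve (k ∷ o ∷ i ∷ s ∷ n ∷ []))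

-- Excluding digons

module _ {n} {G : Config n} (H : Dense G) where
  open Config G
  open Config (dual G) using () renaming (Out to In; Out? to In?)
  open Dense H

  -- `miss z ≤ k - 1` makes `degS u ≤ k + 1`, which density at `u` allows only if nothing is missing
  -- there.
  digon⇒no-miss : ∀ {u α β z} → α ∈ S u → β ∈ S u → α ≢ β →
                  Arc D u z → C u z ≡ α → Arc D z u → C z u ≡ β → miss G u ≤ 0
  digon⇒no-miss {u} {z = z} α∈ β∈ α≢β uz p zu q =
    cancel (dense u) (digon⇒degS≤2+miss G α∈ β∈ α≢β uz p zu q) (miss<k H z)
    where
    cancel : ∀ {k s m m′} → suc k + m ≤ s → s ≤ 2 + m′ → suc m′ ≤ k → m ≤ 0
    cancel {k} {s} {m} {m′} h₁ h₂ h₃ = slack 0 (+-mono-≤ h₁ (+-mono-≤ h₂ h₃)) (solve (k ∷ s ∷ m ∷ m′ ∷ []))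

  -- Density at `u` forces `miss z ≥ k - 1`, and density at `z` turns this into colours.
  digon⇒2k≤degS : ∀ {u α β z} → α ∈ S u → β ∈ S u → α ≢ β →
                  Arc D u z → C u z ≡ α → Arc D z u → C z u ≡ β → k + k ≤ degS G z
  digon⇒2k≤degS {u} {z = z} α∈ β∈ α≢β uz p zu q =
    cancel {k} (dense u) (digon⇒degS≤2+miss G α∈ β∈ α≢β uz p zu q) (dense z)
    where
    cancel : ∀ {k s m m′ s′} → suc k + m ≤ s → s ≤ 2 + m′ → suc k + m′ ≤ s′ → k + k ≤ s′
    cancel {k} {s} {m} {m′} {s′} h₁ h₂ h₃ =
      slack m (+-mono-≤ h₁ (+-mono-≤ h₂ h₃)) (solve (k ∷ s ∷ m ∷ m′ ∷ s′ ∷ []))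

  -- The colours of `S z` need distinct heads, and there are at most `2k` other vertices, so none
  -- can be spared.
  2k≤degS⇒all-out : ∀ {z} → PureOut G z → k + k ≤ degS G z → ∀ {t} → t ≢ z → Arc D z t × C z t ∈ S z
  2k≤degS⇒all-out {z} pure 2k≤ {t} t≢z =
    decidable-stable (T? (arc D z t) ×-dec (C z t ∈? S z)) λ ¬zt →
      clash {k} (pigeonhole (λ γ x → C z x ≡ γ) (S! z) (total ¬zt) λ { _ _ refl refl → refl })
            (1+without≤length _≟_ (others! z) (∈-others t≢z)) (1+length-others≤n z) n≤ 2k≤
    where
    open DecMembership _≟ℕ_ using (_∈?_)
    total : ¬ (Arc D z t × C z t ∈ S z) → ∀ {γ} → γ ∈ S z → ∃[ x ] x ∈ _without_ _≟_ (others z) t × C z x ≡ γ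
    total ¬zt γ∈ with used γ∈
    ... | inj₂ γ-in = contradiction γ-in (All.lookup pure γ∈)
    ... | inj₁ (x , zx , refl) = x , ∈-without⁺ _≟_ (∈-others (arc⇒≢ D zx ∘ sym)) (λ { refl → ¬zt (zx , γ∈) }) , refl
    clash : ∀ {k s r o n} → s ≤ r → suc r ≤ o → suc o ≤ n → n ≤ 1 + (k + k) → k + k ≤ s → ⊥
    clash {k} {s} {r} {o} {n} h₁ h₂ h₃ h₄ h₅ =
      surplus⇒⊥ 0 (+-mono-≤ h₁ (+-mono-≤ h₂ (+-mono-≤ h₃ (+-mono-≤ h₄ h₅)))) (solve (k ∷ s ∷ r ∷ o ∷ n ∷ []))

  3≤degS : ∀ u → 3 ≤ degS G u
  3≤degS u = ≤-trans (s≤s 2≤k) (≤-trans (m≤m+n (suc k) (miss G u)) (dense u))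

  -- Here `z` sends a colour of `S z` to every other vertex, and every other vertex sends an arc to
  -- `u`. The triangles `u → z → t → u` then force the colour `α` on all `t → u` with `t ≠ z`, and a
  -- third colour of `S u` has no place.
  pureOut⇒¬digon : ∀ {u α β z} → PureOut G z → α ∈ S u → β ∈ S u → α ≢ β →
                   Arc D u z → C u z ≡ α → Arc D z u → C z u ≡ β → ⊥
  pureOut⇒¬digon {u} {α} {β} {z} pure α∈ β∈ α≢β uz refl zu refl = third (fresh _≟ℕ_ (S! u) (3≤degS u))
    where
    2k≤ = digon⇒2k≤degS α∈ β∈ α≢β uz refl zu refl

    into-u : ∀ {t} → t ≢ u → Arc D t u
    into-u = no-miss⇒arc G (digon⇒no-miss α∈ β∈ α≢β uz refl zu refl)

    into-u-α : ∀ {t} → t ≢ u → t ≢ z → C t u ≡ α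
    into-u-α t≢u t≢z with 2k≤degS⇒all-out pure 2k≤ t≢z
    ... | zt , zt∈S with nonRainbow _ _ _ uz zt (into-u t≢u)
    ... | inj₁ eq = contradiction (_ , uz , eq) (All.lookup pure zt∈S)
    ... | inj₂ (inj₁ eq) = contradiction (sym eq) (avoids G zt∈S t≢z (arc⇒≢ D uz) (into-u t≢u))
    ... | inj₂ (inj₂ eq) = sym eq

    third : (∃[ δ ] δ ∈ S u × δ ≢ α × δ ≢ β) → ⊥
    third (δ , δ∈ , δ≢α , δ≢β) with used δ∈
    third (δ , δ∈ , δ≢α , δ≢β) | inj₂ (y , yu , refl) with y ≟ z
    ... | yes refl = δ≢β refl
    ... | no  y≢z  = δ≢α (into-u-α (arc⇒≢ D yu) y≢z)
    -- All arcs into `u` have colour `α` or `β`, so by `opposite-missing` the head `x` of an arc in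
    -- colour `δ` sends arcs to no vertex except possibly `u`, which is more than `miss x < k`
    -- permits.
    third (δ , δ∈ , δ≢α , δ≢β) | inj₁ (x , ux , refl) =
      clash (n≤1+length-others x) (length≤1+without _≟_ u (others! x)) (⊆⇒length≤ (without⁺ _≟_ u (others! x)) sub)
            (≤-trans (s≤s (m≤m+n _ _)) (miss<k H x)) 2k≤ (1+degS≤n H z)
      where
      sub : _without_ _≟_ (others x) u ⊆ missing D x
      sub {t} t∈ with ∈-without⁻ _≟_ (others x) t∈
      ... | t∈others , t≢u with ∈-without⁻ _≟_ (allFin n) t∈others | t ≟ z
      ... | _ , t≢x | yes refl = ∈-missing {D = D} t≢x (opposite-missing G δ∈ β∈ δ≢β ux refl zu refl)
      ... | _ , t≢x | no t≢z =
        ∈-missing {D = D} t≢x (opposite-missing G δ∈ α∈ δ≢α ux refl (into-u t≢u) (into-u-α t≢u t≢z))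
      clash : ∀ {k s r o n m} → n ≤ suc o → o ≤ suc r → r ≤ m → suc m ≤ k → k + k ≤ s → suc s ≤ n → ⊥
      clash {k} {s} {r} {o} {n} {m} h₁ h₂ h₃ h₄ h₅ h₆ = <⇒≱ {0} {k} (≤-trans (s≤s z≤n) h₄)
        (slack 0 (+-mono-≤ h₁ (+-mono-≤ h₂ (+-mono-≤ h₃ (+-mono-≤ h₄ (+-mono-≤ h₅ h₆))))) (solve (k ∷ s ∷ r ∷ o ∷ n ∷ m ∷ [])))

module _ {n} {G : Config n} (H : Dense G) where
  open Config G
  open Config (dual G) using () renaming (Out to In; Out? to In?)
  open Dense H

  -- If `z` has an incoming colour, then `degS z ≥ 2k` is maximum, so `z` has no outgoing colour and
  -- the mirror image of `pureOut⇒¬digon` applies.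
  noDigon : ∀ u → NoDigon G u
  noDigon u {z = z} α∈ β∈ α≢β uz p zu q with pureOut? G z
  ... | yes pure = pureOut⇒¬digon H pure α∈ β∈ α≢β uz p zu q
  ... | no ¬pure with impure (dual G) ¬pure
  ... | γ , γ∈ , γ-in =
    pureOut⇒¬digon (dual-dense H) (All.tabulate λ δ∈ δ-out → max⇒pure H max δ∈ δ-out γ∈ γ-in) β∈ α∈ (α≢β ∘ sym) zu q uz p
    where
    max : ∀ w → degS G w ≤ degS G z
    max w = cancel {k} (1+degS≤n H w) n≤ (digon⇒2k≤degS H α∈ β∈ α≢β uz p zu q)
      where
      cancel : ∀ {k s s′ n} → suc s′ ≤ n → n ≤ 1 + (k + k) → k + k ≤ s → s′ ≤ s
      cancel {k} {s} {s′} {n} h₁ h₂ h₃ = slack 0 (+-mono-≤ h₁ (+-mono-≤ h₂ h₃)) (solve (k ∷ s ∷ s′ ∷ n ∷ []))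

  -- Pure and mixed vertices

  -- If all colours of `S x` were outgoing, all but that of `x → u` would lead to vertices `w` with
  -- `w → u` missing; these are at least `k`, against `miss u < k`.
  out-only⇒¬pureOut : ∀ {u α x} → α ∈ S u → ¬ In u α → Arc D u x → C u x ≡ α → ¬ PureOut G x
  out-only⇒¬pureOut {u} {α} {x} α∈ α∉In ux refl pure =
    clash (≤-trans (m≤m+n (suc k) (miss G x)) (dense x)) (length≤1+without _≟ℕ_ (C x u) (S! x))
          (pigeonhole (λ β w → C x w ≡ β) (without⁺ _≟ℕ_ (C x u) (S! x)) total λ { _ _ refl refl → refl })
          (≤-trans (s≤s (missingIn≤miss G u)) (miss<k H u))
    where
    total : ∀ {β} → β ∈ _without_ _≟ℕ_ (S x) (C x u) → ∃[ w ] w ∈ missing (D ᵒ) u × C x w ≡ β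
    total β∈ with ∈-without⁻ _≟ℕ_ (S x) β∈
    ... | β∈S , β≢xu with used β∈S
    ... | inj₂ β-in = contradiction β-in (All.lookup pure β∈S)
    ... | inj₁ (w , xw , refl) = w , ∈-missing {D = D ᵒ} w≢u (return-missing G α∈ α∉In ux refl β∈S xw refl w≢u) , refl
      where
      w≢u : w ≢ u
      w≢u refl = β≢xu refl
    clash : ∀ {k s r m} → suc k ≤ s → s ≤ suc r → r ≤ m → suc m ≤ k → ⊥
    clash {k} {s} {r} {m} h₁ h₂ h₃ h₄ = surplus⇒⊥ 0 (+-mono-≤ h₁ (+-mono-≤ h₂ (+-mono-≤ h₃ h₄))) (solve (k ∷ s ∷ r ∷ m ∷ []))

module _ {n} {G : Config n} (H : Dense G) where
  open Config G
  open Config (dual G) using () renaming (Out to In; Out? to In?)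
  open Dense H

  private
    pureIns = filter (pureIn? G) (allFin n)

  -- The colours of `S b` come from distinct tails, none of them `PureIn` by the mirror image of
  -- `out-only⇒¬pureOut`.
  pureIns+degS≤n : ∀ {b} → PureIn G b → length pureIns + degS G b ≤ n
  pureIns+degS≤n {b} pure = begin
    length pureIns + degS G b                                      ≤⟨ +-monoʳ-≤ (length pureIns) degS≤notPureIn ⟩
    length pureIns + length (filter (¬? ∘ pureIn? G) (allFin n))   ≡⟨ length-filter-∁ (pureIn? G) (allFin n) ⟩
    length (allFin n)                                              ≡⟨ length-allFin n ⟩
    n                                                              ∎
    where
    open ≤-Reasoning
    total : ∀ {α} → α ∈ S b → ∃[ y ] y ∈ filter (¬? ∘ pureIn? G) (allFin n) × C y b ≡ α
    total α∈ with used α∈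
    ... | inj₁ α-out = contradiction α-out (All.lookup pure α∈)
    ... | inj₂ (y , yb , refl) = y , ∈-filter⁺ _ (∈-allFin y)
      (out-only⇒¬pureOut (dual-dense H) α∈ (All.lookup pure α∈) yb refl) , refl
    degS≤notPureIn : degS G b ≤ length (filter (¬? ∘ pureIn? G) (allFin n))
    degS≤notPureIn = pigeonhole (λ α y → C y b ≡ α) (S! b) total λ { _ _ refl refl → refl }

  k<degS : ∀ v → suc k ≤ degS G v
  k<degS v = ≤-trans (m≤m+n (suc k) (miss G v)) (dense v)

  -- The heads of the only-outgoing colours have too large an `S` to be mixed, so they are `PureIn`.
  -- Their number and the size of their `S` are then limited together by `pureIns+degS≤n`, which
  -- leaves at most `k` colours for `S u`.
  maxMixed⇒in : ∀ {u α} → Mixed G u → (∀ w → Mixed G w → degS G w ≤ degS G u) → α ∈ S u → ¬ In u α → ⊥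
  maxMixed⇒in {u} {α} (_ , ¬pureOut) max α∈ α∉In =
    clash (length-filter-∁ (In? u) (S u)) onlyOut≤pureIns (proj₁ (heads α∈onlyOut)) (k<degS u) n≤
    where
    ins = filter (In? u) (S u)
    onlyOut = filter (¬? ∘ In? u) (S u)
    α∈onlyOut : α ∈ onlyOut
    α∈onlyOut = ∈-filter⁺ (¬? ∘ In? u) α∈ α∉In

    out : ∀ {γ} → γ ∈ onlyOut → γ ∈ S u × ¬ In u γ × Out u γ
    out γ∈ with ∈-filter⁻ (¬? ∘ In? u) {xs = S u} γ∈
    ... | γ∈S , γ∉In with used γ∈S
    ... | inj₁ γ-out = γ∈S , γ∉In , γ-out
    ... | inj₂ γ-in = contradiction γ-in γ∉In

    -- As `u` is mixed, some `y → u` has a colour of `S u`, and each only-outgoing colour costs `y`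
    -- an arc.
    onlyOut<k : length onlyOut < k
    onlyOut<k with impure (dual G) ¬pureOut
    ... | β , β∈ , β-in@(y , yu , yu≡β) =
      ≤-trans (s≤s (≤-trans (outs-missing G (noDigon H u) β∈ yu yu≡β (filter⁺ (¬? ∘ In? u) (S! u)) differ)
                            (missingIn≤miss G y))) (miss<k H y)
      where
      differ : ∀ {γ} → γ ∈ onlyOut → γ ∈ S u × Out u γ × γ ≢ β
      differ γ∈ with out γ∈
      ... | γ∈S , γ∉In , γ-out = γ∈S , γ-out , λ { refl → γ∉In β-in }

    head-degS : ∀ {γ x} → γ ∈ S u → ¬ In u γ → Arc D u x → C u x ≡ γ → suc k + length ins ≤ degS G x
    head-degS {γ} {x} γ∈S γ∉In ux p = ≤-trans
      (+-monoʳ-≤ (suc k) (≤-trans (outs-missing (dual G) (noDigon (dual-dense H) u) γ∈S ux p (filter⁺ (In? u) (S! u)) differ)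
                                  (m≤m+n _ _)))
      (dense x)
      where
      differ : ∀ {β} → β ∈ ins → β ∈ S u × In u β × β ≢ γ
      differ β∈ with ∈-filter⁻ (In? u) {xs = S u} β∈
      ... | β∈S , β-in = β∈S , β-in , λ { refl → γ∉In β-in }

    -- The head has `degS x ≥ k + 1 + length ins`, more than `degS u`; by maximality it is not
    -- mixed.
    head-pureIn : ∀ {γ x} → γ ∈ S u → ¬ In u γ → Arc D u x → C u x ≡ γ → PureIn G x
    head-pureIn {γ} {x} γ∈S γ∉In ux p = decidable-stable (pureIn? G x) λ ¬pureIn →
      clash′ (length-filter-∁ (In? u) (S u)) (head-degS γ∈S γ∉In ux p) onlyOut<k
             (max x (¬pureIn , out-only⇒¬pureOut H γ∈S γ∉In ux p))
      where
      clash′ : ∀ {k i o s s′} → i + o ≡ s → suc k + i ≤ s′ → suc o ≤ k → s′ ≤ s → ⊥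
      clash′ {k} {i} {o} {s} {s′} h₁ h₂ h₃ h₄ =
        surplus⇒⊥ 1 (+-mono-≤ (≤-reflexive (sym h₁)) (+-mono-≤ h₂ (+-mono-≤ h₃ h₄))) (solve (k ∷ i ∷ o ∷ s ∷ s′ ∷ []))

    heads : ∀ {γ} → γ ∈ onlyOut → length pureIns + (suc k + length ins) ≤ n × (∃[ x ] x ∈ pureIns × C u x ≡ γ)
    heads γ∈ with out γ∈
    ... | γ∈S , γ∉In , (x , ux , p) =
      ≤-trans (+-monoʳ-≤ (length pureIns) (head-degS γ∈S γ∉In ux p)) (pureIns+degS≤n x-pure)
      , x , ∈-filter⁺ (pureIn? G) (∈-allFin x) x-pure , p
      where
      x-pure = head-pureIn γ∈S γ∉In ux p

    onlyOut≤pureIns : length onlyOut ≤ length pureIns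
    onlyOut≤pureIns = pigeonhole (λ γ x → C u x ≡ γ) (filter⁺ (¬? ∘ In? u) (S! u)) (proj₂ ∘ heads) λ { _ _ refl refl → refl }

    clash : ∀ {k i o s b n} → i + o ≡ s → o ≤ b → b + (suc k + i) ≤ n → suc k ≤ s → n ≤ 1 + (k + k) → ⊥
    clash {k} {i} {o} {s} {b} {n} h₁ h₂ h₃ h₄ h₅ =
      surplus⇒⊥ 0 (+-mono-≤ (≤-reflexive (sym h₁)) (+-mono-≤ h₂ (+-mono-≤ h₃ (+-mono-≤ h₄ h₅)))) (solve (k ∷ i ∷ o ∷ s ∷ b ∷ n ∷ []))

module _ {n} {G : Config n} (H : Dense G) where
  open Config G
  open Config (dual G) using () renaming (Out to In; Out? to In?)
  open Dense H

  -- At a mixed vertex `u` with maximum `degS` every colour of `S u` occurs in both directions.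
  -- Against one incoming arc `y → u` the other colours, at least `k` of them, cost `y` as many
  -- arcs.
  ¬mixed : ∀ v → ¬ Mixed G v
  ¬mixed v mixed with maximum (degS G) (∈-filter⁺ (mixed? G) (∈-allFin v) mixed)
  ... | u , u∈ , max = bothWays (proj₂ (inhabited (≤-trans (s≤s z≤n) (k<degS H u))))
    where
    u-mixed : Mixed G u
    u-mixed = proj₂ (∈-filter⁻ (mixed? G) {xs = allFin n} u∈)
    max′ : ∀ w → Mixed G w → degS G w ≤ degS G u
    max′ w w-mixed = max (∈-filter⁺ (mixed? G) (∈-allFin w) w-mixed)
    all-in : ∀ {α} → α ∈ S u → In u α
    all-in α∈ = decidable-stable (In? u _) (maxMixed⇒in H u-mixed max′ α∈)
    all-out : ∀ {α} → α ∈ S u → Out u α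
    all-out α∈ = decidable-stable (Out? u _) (maxMixed⇒in (dual-dense H) (swap-× u-mixed) (λ w → max′ w ∘ swap-×) α∈)
    bothWays : ∀ {α} → α ∈ S u → ⊥
    bothWays α∈ = in-and-out α∈ (all-in α∈)
      where
      in-and-out : ∀ {α} → α ∈ S u → In u α → ⊥
      in-and-out {α} α∈ (y , yu , p) = clash (k<degS H u) (length≤1+without _≟ℕ_ α (S! u))
                               (outs-missing G (noDigon H u) α∈ yu p (without⁺ _≟ℕ_ α (S! u)) out)
                               (≤-trans (s≤s (missingIn≤miss G y)) (miss<k H y))
        where
        out : ∀ {γ} → γ ∈ _without_ _≟ℕ_ (S u) α → γ ∈ S u × Out u γ × γ ≢ α
        out γ∈ with ∈-without⁻ _≟ℕ_ (S u) γ∈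
        ... | γ∈S , γ≢α = γ∈S , all-out γ∈S , γ≢α
        clash : ∀ {k s r m} → suc k ≤ s → s ≤ suc r → r ≤ m → suc m ≤ k → ⊥
        clash {k} {s} {r} {m} h₁ h₂ h₃ h₄ = surplus⇒⊥ 0 (+-mono-≤ h₁ (+-mono-≤ h₂ (+-mono-≤ h₃ h₄))) (solve (k ∷ s ∷ r ∷ m ∷ []))

  -- The presence of `b` leaves at least `k + 1` vertices outside `PureIn`, hence in `PureOut`. With
  -- both classes inhabited, each has at most `n - k - 1` members, too few to cover all vertices.
  ¬pureIn : ∀ {b} → ¬ PureIn G b
  ¬pureIn {b} b-pure = pureOutExists (inhabited {xs = pureOuts} (cancel (k<degS H b) (pureIns+degS≤n H b-pure) n≤sum))
    where
    pureIns = filter (pureIn? G) (allFin n)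
    pureOuts = filter (pureOut? G) (allFin n)
    n≤sum : n ≤ length pureIns + length pureOuts
    n≤sum = begin
      n                                                              ≡⟨ length-allFin n ⟨
      length (allFin n)                                              ≡⟨ length-filter-∁ (pureIn? G) (allFin n) ⟨
      length pureIns + length (filter (¬? ∘ pureIn? G) (allFin n))   ≤⟨ +-monoʳ-≤ (length pureIns) (⊆⇒length≤ (filter⁺ _ (allFin⁺ n)) sub) ⟩
      length pureIns + length pureOuts                               ∎
      where
      open ≤-Reasoning
      sub : filter (¬? ∘ pureIn? G) (allFin n) ⊆ pureOuts
      sub {v} v∈ = ∈-filter⁺ (pureOut? G) (∈-allFin v) (decidable-stable (pureOut? G v) λ ¬pureOut →
        ¬mixed v (proj₂ (∈-filter⁻ (¬? ∘ pureIn? G) {xs = allFin n} v∈) , ¬pureOut))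
    cancel : ∀ {k s i o n} → suc k ≤ s → i + s ≤ n → n ≤ i + o → 1 ≤ o
    cancel {k} {s} {i} {o} {n} h₁ h₂ h₃ = slack k (+-mono-≤ h₁ (+-mono-≤ h₂ h₃)) (solve (k ∷ s ∷ i ∷ o ∷ n ∷ []))
    pureOutExists : (∃[ a ] a ∈ pureOuts) → ⊥
    pureOutExists (a , a∈) = clash (k<degS H b) (pureIns+degS≤n H b-pure) (k<degS H a)
      (pureIns+degS≤n (dual-dense H) (proj₂ (∈-filter⁻ (pureOut? G) {xs = allFin n} a∈))) n≤sum n≤
      where
      clash : ∀ {k s s′ i o n} → suc k ≤ s → i + s ≤ n → suc k ≤ s′ → o + s′ ≤ n → n ≤ i + o → n ≤ 1 + (k + k) → ⊥
      clash {k} {s} {s′} {i} {o} {n} h₁ h₂ h₃ h₄ h₅ h₆ =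
        surplus⇒⊥ 0 (+-mono-≤ h₁ (+-mono-≤ h₂ (+-mono-≤ h₃ (+-mono-≤ h₄ (+-mono-≤ h₅ h₆))))) (solve (k ∷ s ∷ s′ ∷ i ∷ o ∷ n ∷ []))

¬dense : ∀ {n} {G : Config (suc n)} → ¬ Dense G
¬dense {G = G} H = ¬mixed H zero (¬pureIn H , ¬pureIn (dual-dense H))

-- Arcs and colours of a digraph

Pair : ℕ → Set
Pair n = Fin n × Fin n

_≟ₚ_ : ∀ {n} → DecidableEquality (Pair n)
_≟ₚ_ = ≡-dec _≟_ _≟_

offDiagonal : ∀ n → List (Pair n)
offDiagonal n = filter (λ p → ¬? (proj₁ p ≟ proj₂ p)) (cartesianProduct (allFin n) (allFin n))

∈-offDiagonal : ∀ {n} {x y : Fin n} → x ≢ y → (x , y) ∈ offDiagonal n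
∈-offDiagonal x≢y = ∈-filter⁺ _ (∈-cartesianProduct⁺ (∈-allFin _) (∈-allFin _)) x≢y

module _ {n} (D : Digraph n) where

  ∈-arcs⁺ : ∀ {x y} → Arc D x y → (x , y) ∈ arcs D
  ∈-arcs⁺ xy = ∈-filter⁺ _ (∈-cartesianProduct⁺ (∈-allFin _) (∈-allFin _)) xy

  ∈-arcs⁻ : ∀ {x y} → (x , y) ∈ arcs D → Arc D x y
  ∈-arcs⁻ xy∈ = proj₂ (∈-filter⁻ (λ p → T? (arc D (proj₁ p) (proj₂ p))) {xs = cartesianProduct (allFin n) (allFin n)} xy∈)

  arcs! : Unique (arcs D)
  arcs! = filter⁺ _ (cartesianProduct⁺ (allFin⁺ n) (allFin⁺ n))

  a≤offDiagonal : a D ≤ length (offDiagonal n)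
  a≤offDiagonal = ⊆⇒length≤ arcs! λ xy∈ → ∈-offDiagonal (arc⇒≢ D (∈-arcs⁻ xy∈))

  incomplete⇒a<offDiagonal : ∀ {x y} → x ≢ y → ¬ Arc D x y → a D < length (offDiagonal n)
  incomplete⇒a<offDiagonal {x} {y} x≢y ¬xy = ≤-trans (s≤s (⊆⇒length≤ arcs! sub))
    (1+without≤length _≟ₚ_ (filter⁺ _ (cartesianProduct⁺ (allFin⁺ n) (allFin⁺ n))) (∈-offDiagonal x≢y))
    where
    sub : arcs D ⊆ _without_ _≟ₚ_ (offDiagonal n) (x , y)
    sub pq∈ = ∈-without⁺ _≟ₚ_ (∈-offDiagonal (arc⇒≢ D (∈-arcs⁻ pq∈))) λ { refl → ¬xy (∈-arcs⁻ pq∈) }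

  Complete : Set
  Complete = ∀ x y → x ≢ y → Arc D x y

  complete? : Complete ⊎ (∃[ x ] ∃[ y ] x ≢ y × ¬ Arc D x y)
  complete? with any? (λ x → any? λ y → ¬? (x ≟ y) ×-dec ¬? (T? (arc D x y)))
  ... | yes (x , y , x≢y , ¬xy) = inj₂ (x , y , x≢y , ¬xy)
  ... | no none = inj₁ λ x y x≢y → decidable-stable (T? _) λ ¬xy → none (x , y , x≢y , ¬xy)

  module _ (C : ArcColoring n) where

    colours : List ℕ
    colours = deduplicate _≟ℕ_ (map (λ p → C (proj₁ p) (proj₂ p)) (arcs D))

    colours! : Unique colours
    colours! = deduplicate-! _≟ℕ_ _

    ∈-colours⁺ : ∀ {x y} → Arc D x y → C x y ∈ colours
    ∈-colours⁺ xy = ∈-deduplicate⁺ _≟ℕ_ (∈-map⁺ (λ p → C (proj₁ p) (proj₂ p)) (∈-arcs⁺ xy))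

    ∈-colours⁻ : ∀ {α} → α ∈ colours → ∃[ x ] ∃[ y ] Arc D x y × C x y ≡ α
    ∈-colours⁻ α∈ with ∈-map⁻ (λ p → C (proj₁ p) (proj₂ p)) {xs = arcs D} (∈-deduplicate⁻ _≟ℕ_ (map (λ p → C (proj₁ p) (proj₂ p)) (arcs D)) α∈)
    ... | (x , y) , xy∈ , refl = x , y , ∈-arcs⁻ xy∈ , refl

    c≤length : ∀ {L} → (∀ {x y} → Arc D x y → C x y ∈ L) → c D C ≤ length L
    c≤length {L} sub = ⊆⇒length≤ colours! sub′
      where
      sub′ : colours ⊆ L
      sub′ α∈ with ∈-colours⁻ α∈
      ... | x , y , xy , refl = sub xy

    c≤a : c D C ≤ a D
    c≤a = ≤-trans (length-deduplicate _≟ℕ_ (map (λ p → C (proj₁ p) (proj₂ p)) (arcs D))) (≤-reflexive (length-map _ (arcs D)))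

-- Exhaustive search over coincidences of colours

module _ {n : ℕ} where

  substitute : Pair n → Pair n → Pair n → Pair n
  substitute p q r = if does (r ≟ₚ p) then q else r

  Triple : Set
  Triple = Pair n × Pair n × Pair n

  -- Records the assumption that `p` and `q` are equally coloured: `q` becomes the representative of
  -- both, and `deduplicate` keeps one entry per representative.
  identify : Pair n → Pair n → List Triple × List (Pair n) → List Triple × List (Pair n)
  identify p q (ts , L) = map (λ { (u , v , w) → s u , s v , s w }) ts , deduplicate _≟ₚ_ (map s L)
    where
    s = substitute p q

  -- Tries all ways of making two arcs of each triple equally coloured; L lists representatives of the
  -- colour classes, and the answer is true if at most b of them remain on every branch.
  search : ℕ → ℕ → List Triple × List (Pair n) → Bool
  search fuel b (ts , L) with length L ≤ᵇ b
  search fuel b (ts , L) | true = true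
  search zero b (ts , L) | false = false
  search (suc fuel) b ([] , L) | false = false
  search (suc fuel) b ((p , q , r) ∷ ts , L) | false =
    if does (p ≟ₚ q) ∨ does (q ≟ₚ r) ∨ does (p ≟ₚ r) then search fuel b (ts , L)
    else search fuel b (identify p q (ts , L)) ∧ search fuel b (identify q r (ts , L)) ∧ search fuel b (identify p r (ts , L))

triples : ∀ n → List (Triple {n})
triples n = map (λ { ((x , y) , z) → (x , y) , (y , z) , (z , x) })
  (filter (λ { ((x , y) , z) → ¬? (y ≟ z) ×-dec ¬? (z ≟ x) }) (cartesianProduct (offDiagonal n) (allFin n)))

module _ {n} (C : ArcColoring n) where

  colour : Pair n → ℕ
  colour (x , y) = C x y

  Repeats : Triple {n} → Set
  Repeats (p , q , r) = colour p ≡ colour q ⊎ colour q ≡ colour r ⊎ colour p ≡ colour r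

  colour-substitute : ∀ {p q} → colour p ≡ colour q → ∀ r → colour (substitute p q r) ≡ colour r
  colour-substitute {p} p≡q r with r ≟ₚ p
  ... | yes refl = sym p≡q
  ... | no _ = refl

  repeats-identify : ∀ {p q ts L} → colour p ≡ colour q → All Repeats ts → All Repeats (proj₁ (identify p q (ts , L)))
  repeats-identify {p} {q} p≡q = All.map⁺ ∘ All.map λ { {u , v , w} rep → transport u v w rep }
    where
    s = colour-substitute {p} {q} p≡q
    transport : ∀ u v w → Repeats (u , v , w) → Repeats (substitute p q u , substitute p q v , substitute p q w)
    transport u v w rep rewrite s u | s v | s w = rep

  colours-identify : ∀ {p q L} ts → colour p ≡ colour q → map colour L ⊆ map colour (proj₂ (identify p q (ts , L)))
  colours-identify {p} {q} {L} ts p≡q α∈ with ∈-map⁻ colour {xs = L} α∈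
  ... | r , r∈ , refl = subst (_∈ map colour _) (colour-substitute {p} {q} p≡q r)
    (∈-map⁺ colour (∈-deduplicate⁺ _≟ₚ_ (∈-map⁺ (substitute p q) r∈)))

  FewColours : ℕ → List (Pair n) → Set
  FewColours b L = ∃[ L′ ] length L′ ≤ b × map colour L ⊆ map colour L′

  -- The given colouring satisfies one of the three coincidences at each triple, so it follows one
  -- branch of the search; identifying equally coloured pairs loses no colour.
  search-sound : ∀ fuel b ts L → T (search fuel b (ts , L)) → All Repeats ts → FewColours b L
  search-sound fuel b ts L ok reps with length L ≤ᵇ b in eq
  search-sound fuel b ts L ok reps | true = L , ≤ᵇ⇒≤ _ _ (subst T (sym eq) tt) , id
  search-sound (suc fuel) b ((p , q , r) ∷ ts) L ok (rep All.∷ reps) | false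
    with does (p ≟ₚ q) ∨ does (q ≟ₚ r) ∨ does (p ≟ₚ r)
  ... | true = search-sound fuel b ts L ok reps
  ... | false with Equivalence.to T-∧ ok
  ... | ok₁ , ok₂₃ with Equivalence.to (T-∧ {search fuel b (identify q r (ts , L))}) ok₂₃
  ... | ok₂ , ok₃ = branches rep
    where
    branch : ∀ {u v} → T (search fuel b (identify u v (ts , L))) → colour u ≡ colour v → FewColours b L
    branch {u} {v} ok u≡v with search-sound fuel b _ _ ok (repeats-identify {L = L} u≡v reps)
    ... | L′ , L′≤b , sub = L′ , L′≤b , sub ∘ colours-identify ts u≡v
    branches : Repeats (p , q , r) → FewColours b L
    branches (inj₁ p≡q) = branch ok₁ p≡q
    branches (inj₂ (inj₁ q≡r)) = branch ok₂ q≡r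
    branches (inj₂ (inj₂ p≡r)) = branch ok₃ p≡r

module _ {n} {D : Digraph n} {C : ArcColoring n} (nr : NonRainbow D C) where

  fewColours⇒c≤ : ∀ {b} → FewColours C b (offDiagonal n) → c D C ≤ b
  fewColours⇒c≤ (L , L≤b , sub) = ≤-trans
    (c≤length D C (λ xy → sub (∈-map⁺ (colour C) (∈-offDiagonal (arc⇒≢ D xy)))))
    (≤-trans (≤-reflexive (length-map (colour C) L)) L≤b)

  complete⇒repeats : Complete D → All (Repeats C) (triples n)
  complete⇒repeats complete = All.map⁺ (All.tabulate λ {t} → repeats t)
    where
    distinct? = λ (t : Pair n × Fin n) → ¬? (proj₂ (proj₁ t) ≟ proj₂ t) ×-dec ¬? (proj₂ t ≟ proj₁ (proj₁ t))
    repeats : ∀ t → t ∈ filter distinct? (cartesianProduct (offDiagonal n) (allFin n)) → _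
    repeats ((x , y) , z) t∈ with ∈-filter⁻ distinct? {xs = cartesianProduct (offDiagonal n) (allFin n)} t∈
    ... | t∈′ , y≢z , z≢x with ∈-cartesianProduct⁻ (offDiagonal n) (allFin n) t∈′
    ... | xy∈ , _ = nr _ _ _ (complete _ _ (proj₂ (∈-filter⁻ (λ p → ¬? (proj₁ p ≟ proj₂ p)) {xs = cartesianProduct (allFin n) (allFin n)} xy∈))) (complete _ _ y≢z) (complete _ _ z≢x)

  search⇒c≤ : ∀ fuel b → T (search fuel b (triples n , offDiagonal n)) → Complete D → c D C ≤ b
  search⇒c≤ fuel b ok complete = fewColours⇒c≤ (search-sound C fuel b _ _ ok (complete⇒repeats complete))

  search-identified⇒c≤ : ∀ fuel b p q → T (search fuel b (identify p q (triples n , offDiagonal n))) →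
                         Complete D → colour C p ≡ colour C q → c D C ≤ b
  search-identified⇒c≤ fuel b p q ok complete p≡q with
    search-sound C fuel b _ _ ok (repeats-identify C {L = offDiagonal n} p≡q (complete⇒repeats complete))
  ... | L , L≤b , sub = fewColours⇒c≤ (L , L≤b , sub ∘ colours-identify C (triples n) p≡q)

-- Three vertices, and extremal configurations on four

a+c≤10 : ∀ {D : Digraph 3} {C} → NonRainbow D C → a D + c D C ≤ 10
a+c≤10 {D} {C} nr with complete? D
-- Six arcs and at most four colours, two for each of the two directed triangles; without
-- completeness there are at most five of each.
... | inj₁ complete = +-mono-≤ (a≤offDiagonal D) (search⇒c≤ {D = D} nr 24 4 tt complete)
... | inj₂ (x , y , x≢y , ¬xy) with incomplete⇒a<offDiagonal D x≢y ¬xy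
... | s≤s a≤5 = +-mono-≤ a≤5 (≤-trans (c≤a D C) a≤5)

-- The fuel is the number of triples on four vertices, one being consumed at each step.
sharedTailSearch : (y x x′ : Fin 4) → Bool
sharedTailSearch y x x′ = search 24 5 (identify (y , x) (y , x′) (triples 4 , offDiagonal 4))

sharedTailSearch-succeeds : ∀ y x x′ → y ≢ x → y ≢ x′ → x ≢ x′ → T (sharedTailSearch y x x′)
sharedTailSearch-succeeds = from-yes (all? λ y → all? λ x → all? λ x′ →
  ¬? (y ≟ x) →-dec ¬? (y ≟ x′) →-dec ¬? (x ≟ x′) →-dec T? (sharedTailSearch y x x′))

ProperOut : ∀ {n} → ArcColoring n → Set
ProperOut C = ∀ {y x x′} → y ≢ x → y ≢ x′ → x ≢ x′ → C y x ≢ C y x′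

-- A complete digraph on 4 vertices with 6 colours is extremal, and then it is coloured by two opposite
-- directed 4-cycles with the remaining arcs in singleton classes; only properness is needed.
properOut₄ : ∀ {D : Digraph 4} {C} → NonRainbow D C → Complete D → 6 ≤ c D C → ProperOut C
properOut₄ {D} {C} nr complete 6≤c {y} {x} {x′} y≢x y≢x′ x≢x′ eq = <⇒≱ 6≤c
  (search-identified⇒c≤ {D = D} nr 24 5 (y , x) (y , x′) (sharedTailSearch-succeeds y x x′ y≢x y≢x′ x≢x′) complete eq)

c≤c-ᵒ : ∀ {n} (D : Digraph n) C → c D C ≤ c (D ᵒ) (flip C)
c≤c-ᵒ D C = c≤length D C (∈-colours⁺ (D ᵒ) (flip C))

-- A missing arc x → y is filled in with the colour of y → w after that colour has absorbed the colour of
-- y → z: the arc is gained, at most one colour is lost, and no rainbow triangle appears as y → z and y → w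
-- are the only continuations of x → y.
module Fill (D : Digraph 4) (C : ArcColoring 4) (nr : NonRainbow D C)
            (x y z w : Fin 4) (x≢y : x ≢ y) (y≢z : y ≢ z) (y≢w : y ≢ w)
            (rest : ∀ r → r ≢ x → r ≢ y → r ≡ z ⊎ r ≡ w) (¬xy : ¬ Arc D x y) where

  new? : ∀ p q → Dec (p ≡ x × q ≡ y)
  new? p q = (p ≟ x) ×-dec (q ≟ y)

  merge : ℕ → ℕ
  merge α with α ≟ℕ C y z
  ... | yes _ = C y w
  ... | no _ = α

  merge-other : ∀ {α} → α ≢ C y z → merge α ≡ α
  merge-other {α} α≢yz with α ≟ℕ C y z
  ... | yes α≡yz = contradiction α≡yz α≢yz
  ... | no _ = refl

  merge-yz : merge (C y z) ≡ C y w
  merge-yz with C y z ≟ℕ C y z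
  ... | yes _ = refl
  ... | no ≢ = contradiction refl ≢

  merge-yw : merge (C y w) ≡ C y w
  merge-yw with C y w ≟ℕ C y z
  ... | yes _ = refl
  ... | no _ = refl

  filled-arc : Fin 4 → Fin 4 → Bool
  filled-arc p q with new? p q
  ... | yes _ = true
  ... | no _ = arc D p q

  filled : Digraph 4
  filled = record { arc = filled-arc ; noLoop = filled-noLoop }
    where
    filled-noLoop : ∀ v → filled-arc v v ≡ false
    filled-noLoop v with new? v v
    ... | yes (refl , refl) = contradiction refl x≢y
    ... | no _ = noLoop D v

  filledC : ArcColoring 4
  filledC p q with new? p q
  ... | yes _ = C y w
  ... | no _ = merge (C p q)

  new-arc : Arc filled x y
  new-arc with new? x y
  ... | yes _ = tt
  ... | no ¬new = contradiction (refl , refl) ¬new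

  old-arc : ∀ {p q} → Arc D p q → Arc filled p q
  old-arc {p} {q} pq with new? p q
  ... | yes _ = tt
  ... | no _ = pq

  arc-cases : ∀ {p q} → Arc filled p q → (p ≡ x × q ≡ y) ⊎ (¬ (p ≡ x × q ≡ y) × Arc D p q)
  arc-cases {p} {q} pq with new? p q
  ... | yes new = inj₁ new
  ... | no ¬new = inj₂ (¬new , pq)

  filledC-new : filledC x y ≡ C y w
  filledC-new with new? x y
  ... | yes _ = refl
  ... | no ¬new = contradiction (refl , refl) ¬new

  filledC-old : ∀ {p q} → ¬ (p ≡ x × q ≡ y) → filledC p q ≡ merge (C p q)
  filledC-old {p} {q} ¬new with new? p q
  ... | yes new = contradiction new ¬new
  ... | no _ = refl

  filledC-yz : filledC y z ≡ C y w
  filledC-yz = trans (filledC-old λ { (refl , _) → x≢y refl }) merge-yz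

  filledC-yw : filledC y w ≡ C y w
  filledC-yw = trans (filledC-old λ { (refl , _) → x≢y refl }) merge-yw

  after-new : ∀ {r} → Arc filled y r → Arc filled r x → filledC x y ≡ filledC y r
  after-new {r} yr rx with rest r (arc⇒≢ filled rx) (arc⇒≢ filled yr ∘ sym)
  ... | inj₁ refl = trans filledC-new (sym filledC-yz)
  ... | inj₂ refl = trans filledC-new (sym filledC-yw)

  filled-nonRainbow : NonRainbow filled filledC
  filled-nonRainbow p q r pq qr rp with arc-cases {p} {q} pq | arc-cases {q} {r} qr | arc-cases {r} {p} rp
  ... | inj₁ (refl , refl) | _ | _ = inj₁ (after-new qr rp)
  ... | inj₂ _ | inj₁ (refl , refl) | _ = inj₂ (inj₁ (after-new rp pq))
  ... | inj₂ _ | inj₂ _ | inj₁ (refl , refl) = inj₂ (inj₂ (sym (after-new pq qr)))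
  ... | inj₂ (¬pq , pq′) | inj₂ (¬qr , qr′) | inj₂ (¬rp , rp′)
    rewrite filledC-old ¬pq | filledC-old ¬qr | filledC-old ¬rp with nr _ _ _ pq′ qr′ rp′
  ... | inj₁ eq = inj₁ (cong merge eq)
  ... | inj₂ (inj₁ eq) = inj₂ (inj₁ (cong merge eq))
  ... | inj₂ (inj₂ eq) = inj₂ (inj₂ (cong merge eq))

  a<a-filled : a D < a filled
  a<a-filled = ⊆⇒length≤ {xs = (x , y) ∷ arcs D}
    (All.tabulate (λ { pq∈ refl → ¬xy (∈-arcs⁻ D pq∈) }) ∷! arcs! D)
    λ { (here refl) → ∈-arcs⁺ filled new-arc ; (there pq∈) → ∈-arcs⁺ filled (old-arc (∈-arcs⁻ D pq∈)) }

  c≤1+c-filled : c D C ≤ suc (c filled filledC)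
  c≤1+c-filled = c≤length D C {C y z ∷ colours filled filledC} sub
    where
    sub : ∀ {p q} → Arc D p q → C p q ∈ C y z ∷ colours filled filledC
    sub {p} {q} pq with C p q ≟ℕ C y z
    ... | yes ≡yz = here ≡yz
    ... | no ≢yz = there (subst (_∈ colours filled filledC) unchanged (∈-colours⁺ filled filledC {p} {q} (old-arc pq)))
      where
      unchanged : filledC p q ≡ C p q
      unchanged = trans (filledC-old λ { (refl , refl) → ¬xy pq }) (merge-other ≢yz)

abstract
  rest₄ : (x y : Fin 4) → x ≢ y → ∃[ z ] ∃[ w ] y ≢ z × y ≢ w × z ≢ w × (∀ r → r ≢ x → r ≢ y → r ≡ z ⊎ r ≡ w)
  rest₄ = from-yes (all? λ (x : Fin 4) → all? λ y → ¬? (x ≟ y) →-dec any? λ z → any? λ w →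
    ¬? (y ≟ z) ×-dec ¬? (y ≟ w) ×-dec ¬? (z ≟ w) ×-dec
    all? λ r → ¬? (r ≟ x) →-dec ¬? (r ≟ y) →-dec ((r ≟ z) ⊎-dec (r ≟ w)))

extremal⇒6≤c : ∀ (D : Digraph 4) C → 18 ≤ a D + c D C → 6 ≤ c D C
extremal⇒6≤c D C 18≤ = +-cancelˡ-≤ 12 _ _ (≤-trans 18≤ (+-mono-≤ (a≤offDiagonal D) ≤-refl))

-- The fuel j bounds the number of missing arcs.
extremal⇒complete : ∀ j {D : Digraph 4} {C} → NonRainbow D C → 13 ≤ j + a D → 18 ≤ a D + c D C → Complete D
extremal⇒complete zero {D} nr 13≤ 18≤ = contradiction (a≤offDiagonal D) (<⇒≱ 13≤)
extremal⇒complete (suc j) {D} {C} nr 13≤ 18≤ with complete? D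
... | inj₁ complete = complete
... | inj₂ (x , y , x≢y , ¬xy) with rest₄ x y x≢y
-- The filled digraph is still extremal, so by induction it is complete and hence properly coloured,
-- yet filling gave `y → z` and `y → w` the same colour.
... | z , w , y≢z , y≢w , z≢w , rest = contradiction (trans filledC-yz (sym filledC-yw))
  (properOut₄ {D = filled} filled-nonRainbow complete′ (extremal⇒6≤c filled filledC 18≤′) y≢z y≢w z≢w)
  where
  open Fill D C nr x y z w x≢y y≢z y≢w rest ¬xy
  18≤′ : 18 ≤ a filled + c filled filledC
  18≤′ = cancel 18≤ a<a-filled c≤1+c-filled
    where
    cancel : ∀ {m n m′ n′} → 18 ≤ m + n → suc m ≤ m′ → n ≤ suc n′ → 18 ≤ m′ + n′
    cancel {m} {n} {m′} {n′} h₁ h₂ h₃ = slack 0 (+-mono-≤ h₁ (+-mono-≤ h₂ h₃)) (solve (m ∷ n ∷ m′ ∷ n′ ∷ []))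
  complete′ : Complete filled
  complete′ = extremal⇒complete j {D = filled} filled-nonRainbow
    (≤-trans 13≤ (≤-trans (≤-reflexive (sym (+-suc j (a D)))) (+-monoʳ-≤ j a<a-filled))) 18≤′

-- Deletion of a vertex

infixl 6 _-_
_-_ : ∀ {n} → Digraph (suc n) → Fin (suc n) → Digraph n
D - v = record { arc = λ x y → arc D (punchIn v x) (punchIn v y) ; noLoop = λ x → noLoop D (punchIn v x) }

restrict : ∀ {n} → ArcColoring (suc n) → Fin (suc n) → ArcColoring n
restrict C v x y = C (punchIn v x) (punchIn v y)

punchIn-surjective : ∀ {n} {v x : Fin (suc n)} → x ≢ v → ∃[ x′ ] punchIn v x′ ≡ x
punchIn-surjective x≢v = _ , punchIn-punchOut (x≢v ∘ sym)

module _ {n} (D : Digraph (suc n)) (C : ArcColoring (suc n)) where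

  kept : ∀ v → List ℕ
  kept v = colours (D - v) (restrict C v)

  open DecMembership _≟ℕ_ using (_∈?_)

  lost : Fin (suc n) → List ℕ
  lost v = filter (λ α → ¬? (α ∈? kept v)) (colours D C)

  lost-incident : ∀ {v α x y} → α ∈ lost v → Arc D x y → C x y ≡ α → x ≡ v ⊎ y ≡ v
  lost-incident {v} {α} {x} {y} α∈ xy refl with x ≟ v | y ≟ v
  ... | yes x≡v | _ = inj₁ x≡v
  ... | no _ | yes y≡v = inj₂ y≡v
  ... | no x≢v | no y≢v with punchIn-surjective x≢v | punchIn-surjective y≢v
  ... | x′ , refl | y′ , refl =
    contradiction (∈-colours⁺ (D - v) (restrict C v) xy) (proj₂ (∈-filter⁻ (λ α → ¬? (α ∈? kept v)) {xs = colours D C} α∈))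

  lost-used : ∀ {v α} → α ∈ lost v → (∃[ x ] Arc D v x × C v x ≡ α) ⊎ (∃[ y ] Arc D y v × C y v ≡ α)
  lost-used {v} α∈ with ∈-colours⁻ D C (proj₁ (∈-filter⁻ (λ α → ¬? (α ∈? kept v)) {xs = colours D C} α∈))
  ... | x , y , xy , p with lost-incident α∈ xy p
  ... | inj₁ refl = inj₁ (y , xy , p)
  ... | inj₂ refl = inj₂ (x , xy , p)

  config : NonRainbow D C → Config (suc n)
  config nr = record { D = D ; C = C ; nonRainbow = nr ; S = lost ; S! = λ v → filter⁺ _ (colours! D C)
                     ; incident = lost-incident ; used = lost-used }

  c≤c-delete+lost : ∀ v → c D C ≤ c (D - v) (restrict C v) + length (lost v)
  c≤c-delete+lost v = begin
    length (colours D C)                                        ≡⟨ length-filter-∁ (_∈? kept v) (colours D C) ⟨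
    length (filter (_∈? kept v) (colours D C)) + length (lost v)
      ≤⟨ +-mono-≤ (⊆⇒length≤ (filter⁺ (_∈? kept v) (colours! D C)) (λ α∈ → proj₂ (∈-filter⁻ (_∈? kept v) {xs = colours D C} α∈))) ≤-refl ⟩
    length (kept v) + length (lost v)                           ∎
    where open ≤-Reasoning

  a≤a-delete+degree : ∀ v → a D + (length (missing D v) + length (missing (D ᵒ) v)) ≤ a (D - v) + (n + n)
  a≤a-delete+degree v =
    cancel {a D} {a (D - v)} {length (heads D)} {length (heads (D ᵒ))} {length (missing D v)} {length (missing (D ᵒ) v)}
           (≤-trans (⊆⇒length≤ (arcs! D) sub) (≤-reflexive lengths)) (degree D) (degree (D ᵒ))
    where
    heads : Digraph (suc n) → List (Fin (suc n))
    heads E = filter (λ x → T? (arc E v x)) (others v)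
    degree : ∀ E → length (heads E) + length (missing E v) ≤ n
    degree E = ≤-trans (≤-reflexive (length-filter-∁ (λ x → T? (arc E v x)) (others v))) (s≤s⁻¹ (1+length-others≤n v))
    shift : Pair n → Pair (suc n)
    shift (x , y) = punchIn v x , punchIn v y
    inner = map shift (arcs (D - v))
    outgoing = map (v ,_) (heads D)
    incoming = map (_, v) (heads (D ᵒ))
    lengths : length (inner ++ outgoing ++ incoming) ≡ a (D - v) + (length (heads D) + length (heads (D ᵒ)))
    lengths = trans (length-++ inner) (cong₂ _+_ (length-map shift (arcs (D - v)))
      (trans (length-++ outgoing) (cong₂ _+_ (length-map (v ,_) (heads D)) (length-map (_, v) (heads (D ᵒ))))))
    sub : arcs D ⊆ inner ++ outgoing ++ incoming
    sub {x , y} xy∈ with x ≟ v | y ≟ v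
    ... | yes refl | _ = ∈-++⁺ʳ inner (∈-++⁺ˡ (∈-map⁺ (v ,_) (∈-filter⁺ (λ x → T? (arc D v x)) (∈-others (arc⇒≢ D xy ∘ sym)) xy)))
      where xy = ∈-arcs⁻ D xy∈
    ... | no x≢v | yes refl = ∈-++⁺ʳ inner (∈-++⁺ʳ outgoing (∈-map⁺ (_, v) (∈-filter⁺ (λ x → T? (arc D x v)) (∈-others x≢v) (∈-arcs⁻ D xy∈))))
    ... | no x≢v | no y≢v with punchIn-surjective x≢v | punchIn-surjective y≢v
    ... | x′ , refl | y′ , refl = ∈-++⁺ˡ (∈-map⁺ shift (∈-arcs⁺ (D - v) (∈-arcs⁻ D xy∈)))
    cancel : ∀ {m m′ o i p q n} → m ≤ m′ + (o + i) → o + p ≤ n → i + q ≤ n → m + (p + q) ≤ m′ + (n + n)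
    cancel {m} {m′} {o} {i} {p} {q} {n} h₁ h₂ h₃ =
      slack 0 (+-mono-≤ h₁ (+-mono-≤ h₂ h₃)) (solve (m ∷ m′ ∷ o ∷ i ∷ p ∷ q ∷ n ∷ []))

  a+c-delete : (nr : NonRainbow D C) → ∀ v →
    a D + c D C + miss (config nr) v ≤ a (D - v) + c (D - v) (restrict C v) + (n + n) + degS (config nr) v
  a+c-delete nr v = combine {a D} {a (D - v)} {c D C} {c (D - v) (restrict C v)} {degS (config nr) v} {miss (config nr) v} (a≤a-delete+degree v) (c≤c-delete+lost v)
    where
    combine : ∀ {m m′ c c′ s q n} → m + q ≤ m′ + n → c ≤ c′ + s → m + c + q ≤ m′ + c′ + n + s
    combine {m} {m′} {c} {c′} {s} {q} {n} h₁ h₂ = slack 0 (+-mono-≤ h₁ h₂) (solve (m ∷ m′ ∷ c ∷ c′ ∷ s ∷ q ∷ n ∷ []))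

-- A vertex beside a complete, properly coloured digraph

twoElements : {A : Set} {xs : List A} → Unique xs → 2 ≤ length xs → ∃[ x ] ∃[ y ] x ∈ xs × y ∈ xs × x ≢ y
twoElements {xs = _ ∷ []} _ (s≤s ())
twoElements {xs = x ∷ y ∷ _} (x∉ ∷! _) _ = x , y , here refl , there (here refl) , All.lookup x∉ (here refl)

record Proper {n} (G : Config n) (v : Fin n) : Set where
  open Config G
  field
    complete  : ∀ {x y} → x ≢ v → y ≢ v → x ≢ y → Arc D x y
    properOut : ∀ {y x x′} → y ≢ v → x ≢ v → x′ ≢ v → y ≢ x → y ≢ x′ → x ≢ x′ → C y x ≢ C y x′
    properIn  : ∀ {y x x′} → y ≢ v → x ≢ v → x′ ≢ v → y ≢ x → y ≢ x′ → x ≢ x′ → C x y ≢ C x′ y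

dual-Proper : ∀ {n} {G : Config n} {v} → Proper G v → Proper (dual G) v
dual-Proper P = record { complete = λ x≢v y≢v x≢y → complete y≢v x≢v (x≢y ∘ sym) ; properOut = properIn ; properIn = properOut }
  where open Proper P

module _ {n} (G : Config n) {v} (P : Proper G v) where
  open Config G
  open Config (dual G) using () renaming (Out to In; Out? to In?)
  open Proper P

  -- Otherwise `opposite-missing` would remove `x → y`, which completeness provides.
  digon : ∀ {α β x y} → α ∈ S v → β ∈ S v → α ≢ β → Arc D v x → C v x ≡ α → Arc D y v → C y v ≡ β → x ≡ y
  digon {x = x} {y} α∈ β∈ α≢β vx p yv q = decidable-stable (x ≟ y) λ x≢y →
    opposite-missing G α∈ β∈ α≢β vx p yv q (complete (arc⇒≢ D vx ∘ sym) (arc⇒≢ D yv) x≢y)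

  -- If `y → v` were present, the triangles through `x` and `x′` would give `x → y` and `x′ → y` the
  -- colour of `y → v`, against `properIn`. The alternative, that `y → v` repeats the colour of
  -- `v → x` or `v → x′`, fails by `digon`.
  twoOut⇒missing : ∀ {x x′} → C v x ∈ S v → C v x′ ∈ S v → C v x ≢ C v x′ → Arc D v x → Arc D v x′ →
                   ∀ {y} → y ≢ x → y ≢ x′ → ¬ Arc D y v
  twoOut⇒missing {x} {x′} α∈ β∈ α≢β vx vx′ {y} y≢x y≢x′ yv
    with nonRainbow _ _ _ vx (complete (arc⇒≢ D vx ∘ sym) (arc⇒≢ D yv) (y≢x ∘ sym)) yv
       | nonRainbow _ _ _ vx′ (complete (arc⇒≢ D vx′ ∘ sym) (arc⇒≢ D yv) (y≢x′ ∘ sym)) yv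
  ... | inj₁ eq | _ = avoids G α∈ (arc⇒≢ D vx ∘ sym) (arc⇒≢ D yv) (complete (arc⇒≢ D vx ∘ sym) (arc⇒≢ D yv) (y≢x ∘ sym)) (sym eq)
  ... | _ | inj₁ eq = avoids G β∈ (arc⇒≢ D vx′ ∘ sym) (arc⇒≢ D yv) (complete (arc⇒≢ D vx′ ∘ sym) (arc⇒≢ D yv) (y≢x′ ∘ sym)) (sym eq)
  ... | inj₂ (inj₂ eq) | _ = y≢x′ (sym (digon β∈ α∈ (α≢β ∘ sym) vx′ refl yv (sym eq)))
  ... | _ | inj₂ (inj₂ eq) = y≢x (sym (digon α∈ β∈ α≢β vx refl yv (sym eq)))
  ... | inj₂ (inj₁ eq) | inj₂ (inj₁ eq′) =
    properIn (arc⇒≢ D yv) (arc⇒≢ D vx ∘ sym) (arc⇒≢ D vx′ ∘ sym) y≢x y≢x′ (λ { refl → α≢β refl }) (trans eq (sym eq′))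

module _ {n} (5≤n : 5 ≤ n) (G : Config n) {v} (P : Proper G v) (large : 2 + miss G v ≤ degS G v) where
  open Config G
  open Config (dual G) using () renaming (Out to In; Out? to In?)
  open Proper P

  -- Two outgoing colours exclude arcs into `v` except from their heads, so `miss v ≥ 2` and `S v`
  -- has a third colour. It is outgoing too, by `digon`, and now no arc enters `v`: `large` asks for
  -- more colours than there are heads.
  ¬twoOut : ∀ {α β} → α ∈ S v → β ∈ S v → α ≢ β → Out v α → Out v β → ⊥
  ¬twoOut α∈ β∈ α≢β (x , vx , refl) (x′ , vx′ , refl) = thirdOut (fresh _≟ℕ_ (S! v) (≤-trans (s≤s (s≤s (s≤s z≤n))) 4≤degS))
    where
    missing-in : ∀ {y} → y ≢ v → ¬ Arc D y v → y ∈ missing (D ᵒ) v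
    missing-in = ∈-missing {D = D ᵒ}

    x≢x′ : x ≢ x′
    x≢x′ refl = α≢β refl

    4≤degS : 4 ≤ degS G v
    4≤degS = cancel (≤-trans 5≤n (n≤1+length-others v)) (length≤1+without _≟_ x (others! v)) (length≤1+without _≟_ x′ (without⁺ _≟_ x (others! v)))
                    (⊆⇒length≤ (without⁺ _≟_ x′ (without⁺ _≟_ x (others! v))) sub) (m≤n+m _ _) large
      where
      sub : _without_ _≟_ (_without_ _≟_ (others v) x) x′ ⊆ missing (D ᵒ) v
      sub y∈ with ∈-without⁻ _≟_ (_without_ _≟_ (others v) x) y∈
      ... | y∈′ , y≢x′ with ∈-without⁻ _≟_ (others v) y∈′
      ... | y∈″ , y≢x = missing-in (proj₂ (∈-without⁻ _≟_ (allFin n) y∈″)) (twoOut⇒missing G P α∈ β∈ α≢β vx vx′ y≢x y≢x′)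
      cancel : ∀ {o p q i m s} → 5 ≤ suc o → o ≤ suc p → p ≤ suc q → q ≤ i → i ≤ m → 2 + m ≤ s → 4 ≤ s
      cancel {o} {p} {q} {i} {m} {s} h₁ h₂ h₃ h₄ h₅ h₆ =
        slack 0 (+-mono-≤ h₁ (+-mono-≤ h₂ (+-mono-≤ h₃ (+-mono-≤ h₄ (+-mono-≤ h₅ h₆))))) (solve (o ∷ p ∷ q ∷ i ∷ m ∷ s ∷ []))

    thirdOut : (∃[ γ ] γ ∈ S v × γ ≢ C v x × γ ≢ C v x′) → ⊥
    thirdOut (γ , γ∈ , γ≢α , γ≢β) with used γ∈
    ... | inj₂ (w , wv , p) = x≢x′ (trans (digon G P α∈ γ∈ (γ≢α ∘ sym) vx refl wv p) (sym (digon G P β∈ γ∈ (γ≢β ∘ sym) vx′ refl wv p)))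
    ... | inj₁ (x″ , vx″ , refl) = clash (⊆⇒length≤ (others! v) sub) (m≤n+m _ _) large
                                        (pigeonhole (λ δ z → C v z ≡ δ) (S! v) total λ { _ _ refl refl → refl })
      where
      no-in : ∀ {y} → ¬ Arc D y v
      no-in {y} with y ≟ x | y ≟ x′
      ... | no y≢x | no y≢x′ = twoOut⇒missing G P α∈ β∈ α≢β vx vx′ y≢x y≢x′
      ... | yes refl | _ = twoOut⇒missing G P β∈ γ∈ (γ≢β ∘ sym) vx′ vx″ x≢x′ λ { refl → γ≢α refl }
      ... | no y≢x | yes refl = twoOut⇒missing G P α∈ γ∈ (γ≢α ∘ sym) vx vx″ y≢x λ { refl → γ≢β refl }
      sub : others v ⊆ missing (D ᵒ) v
      sub y∈ = missing-in (proj₂ (∈-without⁻ _≟_ (allFin n) y∈)) no-in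
      total : ∀ {δ} → δ ∈ S v → ∃[ z ] z ∈ others v × C v z ≡ δ
      total δ∈ with used δ∈
      ... | inj₂ (w , wv , _) = contradiction wv no-in
      ... | inj₁ (z , vz , q) = z , ∈-others (arc⇒≢ D vz ∘ sym) , q
      clash : ∀ {o i m s} → o ≤ i → i ≤ m → 2 + m ≤ s → s ≤ o → ⊥
      clash {o} {i} {m} {s} h₁ h₂ h₃ h₄ = surplus⇒⊥ 1 (+-mono-≤ h₁ (+-mono-≤ h₂ (+-mono-≤ h₃ h₄))) (solve (o ∷ i ∷ m ∷ s ∷ []))

module _ {n} (5≤n : 5 ≤ n) (G : Config n) {v} (P : Proper G v) (large : 2 + miss G v ≤ degS G v) where
  open Config G
  open Config (dual G) using () renaming (Out to In; Out? to In?)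
  open Proper P

  ¬twoIn : ∀ {α β} → α ∈ S v → β ∈ S v → α ≢ β → In v α → In v β → ⊥
  ¬twoIn = ¬twoOut 5≤n (dual G) (dual-Proper P) (subst (λ m → 2 + m ≤ degS G v) (miss-ᵒ G v) large)

  module _ {x} (vx : Arc D v x) (xv : Arc D x v) (α∈ : C v x ∈ S v) (β∈ : C x v ∈ S v) (α≢β : C v x ≢ C x v) where

    private
      -- A third colour would be a second outgoing or a second incoming one. So `S v` has just two
      -- colours, and by `large` no arc at `v` is missing.
      no-third : ¬ 3 ≤ degS G v
      no-third 3≤ = third (fresh _≟ℕ_ (S! v) 3≤)
        where
        third : (∃[ γ ] γ ∈ S v × γ ≢ C v x × γ ≢ C x v) → ⊥
        third (γ , γ∈ , γ≢α , γ≢β) with used γ∈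
        ... | inj₁ γ-out = ¬twoOut 5≤n G P large γ∈ α∈ γ≢α γ-out (x , vx , refl)
        ... | inj₂ γ-in = ¬twoIn γ∈ β∈ γ≢β γ-in (x , xv , refl)

      abstract
        no-miss : miss G v ≤ 0
        no-miss = s≤s⁻¹ (s≤s⁻¹ (≤-trans large (s≤s⁻¹ (≰⇒> no-third))))

      into-v : ∀ {y} → y ≢ v → Arc D y v
      into-v = no-miss⇒arc G no-miss

      from-v : ∀ {y} → y ≢ v → Arc D v y
      from-v = no-miss⇒arc (dual G) (subst (_≤ 0) (miss-ᵒ G v) no-miss)

      x≢v = arc⇒≢ D xv

      in-colour : ∀ {y} → y ≢ v → y ≢ x → C y v ≡ C x y
      in-colour {y} y≢v y≢x with nonRainbow _ _ _ vx (complete x≢v y≢v (y≢x ∘ sym)) (into-v y≢v)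
      ... | inj₁ eq = contradiction (sym eq) (avoids G α∈ x≢v y≢v (complete x≢v y≢v (y≢x ∘ sym)))
      ... | inj₂ (inj₁ eq) = sym eq
      ... | inj₂ (inj₂ eq) = ⊥-elim (¬twoIn α∈ β∈ α≢β (y , into-v y≢v , sym eq) (x , xv , refl))

      out-colour : ∀ {y} → y ≢ v → y ≢ x → C v y ≡ C y x
      out-colour {y} y≢v y≢x with nonRainbow _ _ _ (complete y≢v x≢v y≢x) xv (from-v y≢v)
      ... | inj₁ eq = contradiction eq (avoids G β∈ y≢v x≢v (complete y≢v x≢v y≢x))
      ... | inj₂ (inj₁ eq) = ⊥-elim (¬twoOut 5≤n G P large α∈ β∈ α≢β (x , vx , refl) (y , from-v y≢v , sym eq))
      ... | inj₂ (inj₂ eq) = sym eq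

      -- In `v → y → y′ → v` the outer arcs have the colours of `y → x` and `x → y′`; properness
      -- keeps `y → y′` from repeating either, so these two agree.
      through : ∀ {y y′} → y ≢ v → y ≢ x → y′ ≢ v → y′ ≢ x → y ≢ y′ → C y x ≡ C x y′
      through y≢v y≢x y′≢v y′≢x y≢y′ with nonRainbow _ _ _ (from-v y≢v) (complete y≢v y′≢v y≢y′) (into-v y′≢v)
      ... | inj₁ eq = contradiction (trans (sym (out-colour y≢v y≢x)) eq) (properOut y≢v x≢v y′≢v y≢x y≢y′ (y′≢x ∘ sym))
      ... | inj₂ (inj₁ eq) = contradiction (trans eq (in-colour y′≢v y′≢x)) (properIn y′≢v y≢v x≢v (y≢y′ ∘ sym) y′≢x y≢x)
      ... | inj₂ (inj₂ eq) = trans (sym (out-colour y≢v y≢x)) (trans eq (in-colour y′≢v y′≢x))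

      rest = _without_ _≟_ (others v) x

      rest! : Unique rest
      rest! = without⁺ _≟_ x (others! v)

      ∈-rest⁻ : ∀ {y} → y ∈ rest → y ≢ v × y ≢ x
      ∈-rest⁻ y∈ with ∈-without⁻ _≟_ (others v) y∈
      ... | y∈others , y≢x = proj₂ (∈-without⁻ _≟_ (allFin n) y∈others) , y≢x

      3≤rest : 3 ≤ length rest
      3≤rest = s≤s⁻¹ (≤-trans (s≤s⁻¹ (≤-trans 5≤n (n≤1+length-others v))) (length≤1+without _≟_ x (others! v)))

      -- `y₁ → x` and `y₃ → x` both have the colour of `x → y₂`, against `properIn`; three such
      -- vertices exist as `n ≥ 5`.
      conclude : ∀ {y₁ y₂ y₃} → y₁ ∈ rest → y₂ ∈ rest → y₃ ∈ rest → y₂ ≢ y₁ → y₃ ≢ y₁ → y₃ ≢ y₂ → ⊥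
      conclude y₁∈ y₂∈ y₃∈ y₂≢y₁ y₃≢y₁ y₃≢y₂ =
        properIn x≢v y₁≢v y₃≢v (y₁≢x ∘ sym) (y₃≢x ∘ sym) (y₃≢y₁ ∘ sym)
          (trans (through y₁≢v y₁≢x y₂≢v y₂≢x (y₂≢y₁ ∘ sym)) (sym (through y₃≢v y₃≢x y₂≢v y₂≢x y₃≢y₂)))
        where
        y₁≢v = proj₁ (∈-rest⁻ y₁∈)
        y₁≢x = proj₂ (∈-rest⁻ y₁∈)
        y₂≢v = proj₁ (∈-rest⁻ y₂∈)
        y₂≢x = proj₂ (∈-rest⁻ y₂∈)
        y₃≢v = proj₁ (∈-rest⁻ y₃∈)
        y₃≢x = proj₂ (∈-rest⁻ y₃∈)

      threeOthers : (∃[ y₁ ] y₁ ∈ rest) → ⊥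
      threeOthers (y₁ , y₁∈) = withSecond (fresh _≟_ rest! 3≤rest)
        where
        withThird : ∀ {y₂} → y₂ ∈ rest → y₂ ≢ y₁ → (∃[ y₃ ] y₃ ∈ rest × y₃ ≢ y₁ × y₃ ≢ y₂) → ⊥
        withThird y₂∈ y₂≢y₁ (y₃ , y₃∈ , y₃≢y₁ , y₃≢y₂) = conclude y₁∈ y₂∈ y₃∈ y₂≢y₁ y₃≢y₁ y₃≢y₂
        withSecond : (∃[ y₂ ] y₂ ∈ rest × y₂ ≢ y₁ × y₂ ≢ y₁) → ⊥
        withSecond (y₂ , y₂∈ , y₂≢y₁ , _) = withThird y₂∈ y₂≢y₁ (fresh _≟_ rest! 3≤rest)

    ¬digon : ⊥
    ¬digon = threeOthers (inhabited (≤-trans (s≤s z≤n) 3≤rest))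

  ¬outIn : ∀ {α β} → α ∈ S v → β ∈ S v → α ≢ β → Out v α → In v β → ⊥
  ¬outIn α∈ β∈ α≢β (x , vx , refl) (y , yv , refl) with digon G P α∈ β∈ α≢β vx refl yv refl
  ... | refl = ¬digon vx yv α∈ β∈ α≢β

  ¬proper : ⊥
  ¬proper with twoElements (S! v) (≤-trans (s≤s (s≤s z≤n)) large)
  ... | α , β , α∈ , β∈ , α≢β with used α∈ | used β∈
  ... | inj₁ o | inj₁ o′ = ¬twoOut 5≤n G P large α∈ β∈ α≢β o o′
  ... | inj₁ o | inj₂ i = ¬outIn α∈ β∈ α≢β o i
  ... | inj₂ i | inj₁ o = ¬outIn β∈ α∈ (α≢β ∘ sym) o i
  ... | inj₂ i | inj₂ i′ = ¬twoIn α∈ β∈ α≢β i i′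

-- The induction step

Bounded : ℕ → Set
Bounded n = ∀ (D : Digraph n) C → NonRainbow D C → a D + c D C < bound n

-- With m the number of missing arcs at v, s the number of colours lost with v, A and A′ the values of a + c
-- before and after the deletion.
delete-bound : ∀ {A A′ m s N b k} → A + m ≤ A′ + N + s → A′ < b → b + N + k ≤ A → suc k + m ≤ s
delete-bound {A} {A′} {m} {s} {N} {b} {k} h₁ h₂ h₃ =
  slack 0 (+-mono-≤ h₁ (+-mono-≤ h₂ h₃)) (solve (A ∷ A′ ∷ m ∷ s ∷ N ∷ b ∷ k ∷ []))

restrict-nonRainbow : ∀ {n} {D : Digraph (suc n)} {C} → NonRainbow D C → ∀ v → NonRainbow (D - v) (restrict C v)
restrict-nonRainbow nr v x y z = nr (punchIn v x) (punchIn v y) (punchIn v z)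

-- As the bound grows by `n + n + k`, a counterexample whose deletions all obey the smaller bound is
-- dense.
bounded-step : ∀ {n} k → 2 ≤ k → suc n ≤ 1 + (k + k) → bound (suc n) ≡ bound n + (n + n) + k → Bounded n → Bounded (suc n)
bounded-step {n} k 2≤k n≤ bound≡ bounded D C nr = ≰⇒> λ big → ¬dense {G = config D C nr} record
  { k = k ; 2≤k = 2≤k ; n≤ = n≤
  ; dense = λ v → delete-bound {b = bound n} {k} (a+c-delete D C nr v) (bounded (D - v) (restrict C v) (restrict-nonRainbow {D = D} nr v))
                               (≤-trans (≤-reflexive (sym bound≡)) big) }

bounded₅ : Bounded 4 → Bounded 5
bounded₅ bounded D C nr = ≰⇒> λ big → analyse big (any? λ v → 18 ≤?ℕ a (D - v) + c (D - v) (restrict C v))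
  where
  G = config D C nr
  analyse : 28 ≤ a D + c D C → Dec (∃[ v ] 18 ≤ a (D - v) + c (D - v) (restrict C v)) → ⊥
  -- Here every deletion stays below `18` instead of `19`, and `18 + 8 + 2 = 28` gives density with
  -- `k = 2`.
  analyse big (no none) = ¬dense {G = G} record
    { k = 2 ; 2≤k = ≤-refl ; n≤ = ≤-refl
    ; dense = λ v → delete-bound {b = 18} {2} (a+c-delete D C nr v) (≰⇒> λ 18≤ → none (v , 18≤)) big }
  -- With `19 + 8 + 1 = 28` only `2 + miss v ≤ degS v` remains, but `D - v` is now extremal.
  analyse big (yes (v , 18≤)) = ¬proper ≤-refl G proper
    (delete-bound {b = 19} {1} (a+c-delete D C nr v) (bounded (D - v) (restrict C v) nr′) big)
    where
    nr′ = restrict-nonRainbow {D = D} nr v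
    complete′ = extremal⇒complete 13 {D = D - v} nr′ (m≤m+n 13 _) 18≤
    6≤c = extremal⇒6≤c (D - v) (restrict C v) 18≤
    properOut′ = properOut₄ {D = D - v} nr′ complete′ 6≤c
    properIn′ = properOut₄ {D = (D - v) ᵒ} (nonRainbow-ᵒ {D = D - v} nr′) (λ x y x≢y → complete′ y x (x≢y ∘ sym))
                           (≤-trans 6≤c (c≤c-ᵒ (D - v) (restrict C v)))
    proper : Proper G v
    proper = record { complete = complete″ ; properOut = properOut″ ; properIn = properIn″ }
      where
      complete″ : ∀ {x y} → x ≢ v → y ≢ v → x ≢ y → Arc D x y
      complete″ x≢v y≢v x≢y with punchIn-surjective x≢v | punchIn-surjective y≢v
      ... | x , refl | y , refl = complete′ x y λ { refl → x≢y refl }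
      properOut″ : ∀ {y x x′} → y ≢ v → x ≢ v → x′ ≢ v → y ≢ x → y ≢ x′ → x ≢ x′ → C y x ≢ C y x′
      properOut″ y≢v x≢v x′≢v y≢x y≢x′ x≢x′ with punchIn-surjective y≢v | punchIn-surjective x≢v | punchIn-surjective x′≢v
      ... | y , refl | x , refl | x′ , refl =
        properOut′ {y} {x} {x′} (λ { refl → y≢x refl }) (λ { refl → y≢x′ refl }) λ { refl → x≢x′ refl }
      properIn″ : ∀ {y x x′} → y ≢ v → x ≢ v → x′ ≢ v → y ≢ x → y ≢ x′ → x ≢ x′ → C x y ≢ C x′ y
      properIn″ y≢v x≢v x′≢v y≢x y≢x′ x≢x′ with punchIn-surjective y≢v | punchIn-surjective x≢v | punchIn-surjective x′≢v
      ... | y , refl | x , refl | x′ , refl =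
        properIn′ {y} {x} {x′} (λ { refl → y≢x refl }) (λ { refl → y≢x′ refl }) λ { refl → x≢x′ refl }

-- Growth of the bound

quarter-even : ∀ j → (j + j) * (j + j) / 4 ≡ j * j
quarter-even j = trans (/-congˡ {o = 4} (square j)) (m*n/n≡m (j * j) 4)
  where
  square : ∀ j → (j + j) * (j + j) ≡ j * j * 4
  square j = solve (j ∷ [])

quarter-odd : ∀ j → suc (j + j) * suc (j + j) / 4 ≡ j * j + j
quarter-odd j = trans (/-congˡ {o = 4} (square j))
  (trans (+-distrib-/-∣ʳ 1 {d = 4} (divides (j * j + j) refl)) (m*n/n≡m (j * j + j) 4))
  where
  square : ∀ j → suc (j + j) * suc (j + j) ≡ 1 + (j * j + j) * 4
  square j = solve (j ∷ [])

parity : ∀ n → ∃[ j ] (n ≡ j + j ⊎ n ≡ suc (j + j))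
parity zero = 0 , inj₁ refl
parity (suc n) with parity n
... | j , inj₁ refl = j , inj₂ refl
... | j , inj₂ refl = suc j , inj₁ (cong suc (sym (+-suc j j)))

-- The increment `k` is `n/2` rounded up, that is, half of `n + 1` rounded down.
quarter-step : ∀ n → ∃[ k ] n ≤ k + k × suc n * suc n / 4 ≡ n * n / 4 + k
quarter-step n with parity n
... | j , inj₁ refl = j , ≤-refl , trans (quarter-odd j) (cong (_+ j) (sym (quarter-even j)))
... | j , inj₂ refl = suc j , s≤s (≤-trans (m≤n+m (j + j) 1) (≤-reflexive (sym (+-suc j j)))) ,
  trans (cong (λ m → m * m / 4) (cong suc (sym (+-suc j j))))
    (trans (quarter-even (suc j)) (trans (square j) (cong (_+ suc j) (sym (quarter-odd j)))))
  where
  square : ∀ j → suc j * suc j ≡ j * j + j + suc j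
  square j = solve (j ∷ [])

-- From five vertices on, `extra` is constantly `2` and cancels.
bound-step : ∀ m {k} → (6 + m) * (6 + m) / 4 ≡ (5 + m) * (5 + m) / 4 + k →
             bound (6 + m) ≡ bound (5 + m) + ((5 + m) + (5 + m)) + k
bound-step m {k} eq = trans (cong (λ q → (6 + m) * (5 + m) + q + 2) eq) (rearrange m ((5 + m) * (5 + m) / 4) k)
  where
  rearrange : ∀ m q k → (6 + m) * (5 + m) + (q + k) + 2 ≡ (5 + m) * (4 + m) + q + 2 + ((5 + m) + (5 + m)) + k
  rearrange m q k = solve (m ∷ q ∷ k ∷ [])

half-large : ∀ {k} → 3 ≤ k + k → 2 ≤ k
half-large {suc zero} (s≤s (s≤s ()))
half-large {suc (suc k)} _ = s≤s (s≤s z≤n)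

-- The induction and its conclusion

bounded : ∀ m → Bounded (3 + m)
bounded 0 D C nr = s≤s (a+c≤10 {D} nr)
-- Both orders have `extra` equal to `3`, and `19 = 11 + 6 + 2`.
bounded 1 = bounded-step 2 ≤-refl (s≤s (s≤s (s≤s (s≤s z≤n)))) refl (bounded 0)
bounded 2 = bounded₅ (bounded 1)
bounded (suc (suc (suc m))) = step (quarter-step (5 + m)) (bounded (suc (suc m)))
  where
  step : (∃[ k ] 5 + m ≤ k + k × (6 + m) * (6 + m) / 4 ≡ (5 + m) * (5 + m) / 4 + k) → Bounded (5 + m) → Bounded (6 + m)
  step (k , n≤ , eq) = bounded-step k (half-large (≤-trans (s≤s (s≤s (s≤s z≤n))) n≤)) (s≤s n≤) (bound-step m eq)

¬rainbow⇒nonRainbow : ∀ {n} {D : Digraph n} {C} → ¬ RainbowTriangle D C → NonRainbow D C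
¬rainbow⇒nonRainbow {C = C} ¬rainbow x y z xy yz zx with C x y ≟ℕ C y z | C y z ≟ℕ C z x | C x y ≟ℕ C z x
... | yes p | _ | _ = inj₁ p
... | no _ | yes q | _ = inj₂ (inj₁ q)
... | no _ | no _ | yes r = inj₂ (inj₂ r)
... | no p | no q | no r = contradiction (x , y , z , xy , yz , zx , p , q , r) ¬rainbow

rainbow? : ∀ {n} (D : Digraph n) C → Dec (RainbowTriangle D C)
rainbow? D C = any? λ x → any? λ y → any? λ z →
  T? (arc D x y) ×-dec T? (arc D y z) ×-dec T? (arc D z x) ×-dec
  ¬? (C x y ≟ℕ C y z) ×-dec ¬? (C y z ≟ℕ C z x) ×-dec ¬? (C x y ≟ℕ C z x)

theorem3 : (n : ℕ) → n ≥ 3 → (D : Digraph n) → (C : ArcColoring n) →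
    a D + c D C ≥ bound n → RainbowTriangle D C
theorem3 (suc (suc (suc m))) (s≤s (s≤s (s≤s z≤n))) D C large = decidable-stable (rainbow? D C) λ ¬rainbow →
  <⇒≱ (bounded m D C (¬rainbow⇒nonRainbow {D = D} ¬rainbow)) large
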